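{- Let $\delta$ be a unimodal range map and $\mathcal{S}$ be a nonempty graded subset of $\mathsf{Cl}_\delta$. If $\mathcal{S}$ is closed by subword reduction, then $\mathcal{V}_{\mathcal{S}}$ is an operad ideal of $\mathbf{Cl}_\delta$. Therefore, in this case, $\mathbf{Cl}_{\mathcal{S}}:=\mathbf{Cl}_\delta/\mathcal{V}_{\mathcal{S}}$ is a quotient operad of $\mathbf{Cl}_\delta$.
   Context: $\mathbb{N}=\{0,1,2,\dots\}$ and $\mathbb{K}$ is a field of characteristic zero. A range map is a map $\delta:\mathbb{N}\setminus\{0\}\to\mathbb{N}$. It is unimodal if there are no $1\le i_1<i_2<i_3$ with $\delta(i_1)>\delta(i_2)<\delta(i_3)$. For a word $w$ on $\mathbb{N}$, $\ell(w)$ is its length, $w(i)$ its $i$-th letter, $\epsilon$ is the empty word. A $\delta$-cliff is a word $w$ on $\mathbb{N}$ with $0\le w(i)\le\delta(i)$ for all $i$; its size is $|w|:=\ell(w)+1$; $\mathsf{Cl}_\delta$ is the set of all $\delta$-cliffs, graded by size. The $\delta$-reduction of a word $w$ on $\mathbb{N}$ is the $\delta$-cliff $\mathrm{r}_\delta(w)$ of length $\ell(w)$ with $i$-th letter $\min\{w(i),\delta(i)\}$. For words $u,v$ and $1\le i\le|u|$, $u\,\square_i\,v:=u(1)\cdots u(i-1)\;v\;u(i)\cdots u(\ell(u))$. For $\delta$ unimodal, $\mathbf{Cl}_\delta$ is the nonsymmetric operad over $\mathbb{K}$ with basis $\{\mathsf{E}_w:w\in\mathsf{Cl}_\delta\}$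 ($\mathsf{E}_w$ of arity $|w|$), partial compositions $\mathsf{E}_u\circ_i\mathsf{E}_v=\mathsf{E}_{u\,\square_i\,v}$ if $u\,\square_i\,v\in\mathsf{Cl}_\delta$ and $\mathsf{E}_u\circ_i\mathsf{E}_v=0$ otherwise, and unit $\mathsf{E}_\epsilon$. Order: for $u,v$ of the same length, $u\preccurlyeq v$ iff $u(j)\le v(j)$ for all $j$. Fundamental basis of $\mathbf{Cl}_\delta$: $\mathsf{F}_w:=\sum_{w'\in\mathsf{Cl}_\delta,\,w\preccurlyeq w'}\mu_\preccurlyeq(w,w')\,\mathsf{E}_{w'}$, where $\mu_\preccurlyeq$ is the Möbius function of the poset $\preccurlyeq$ on $\delta$-cliffs of a given size; equivalently $\mathsf{E}_w=\sum_{w'\in\mathsf{Cl}_\delta,\,w\preccurlyeq w'}\mathsf{F}_{w'}$. A nonempty graded subset $\mathcal{S}\subseteq\mathsf{Cl}_\delta$ is closed by subword reduction if for any $w\in\mathcal{S}$ and any subword $w'$ of $w$ (a subsequence of not necessarily contiguous letters of $w$, possibly empty), $\mathrm{r}_\delta(w')\in\mathcal{S}$. $\mathcal{V}_{\mathcal{S}}$ is the linear span of $\{\mathsf{F}_w:w\in\mathsf{Cl}_\delta\setminus\mathcal{S}\}$. -}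

module Defs where

open import Algebra.Bundles using (CommutativeRing)
open import Algebra.Definitions using (Invertible)
import Algebra.Definitions.RawMonoid as RawMonoidDefinitions
open import Algebra.Module.Bundles.Raw using (RawLeftModule)
open import Algebra.Module.Morphism.Structures using (module LeftModuleMorphisms)
open import Algebra.Module.Structures using (IsLeftModule)
import Algebra.Properties.Ring as RingProperties
import Algebra.Solver.Ring.NaturalCoefficients.Default as SemiringSolver
open import Data.Empty using (⊥-elim)
open import Data.Fin.Base as Fin using (Fin; zero; suc; toℕ)
open import Data.Fin.Properties as Fin using (all?; toℕ<n)
open import Data.List.Base
  using (List; []; _∷_; _++_; map; concatMap; length; lookup; take; drop; tabulate; upTo; filter; cartesianProductWith)
open import Data.List.Membership.Propositional using (_∈_; mapWith∈)
open import Data.List.Membership.Propositional.Properties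
  using (∈-cartesianProductWith⁻; ∈-upTo⁻)
open import Data.List.Properties
  using (≡-dec; length-++; ++-assoc; ++-identityʳ; length-take; take++drop≡id; length-tabulate; ∷-injective)
open import Data.List.Relation.Binary.Pointwise as Pointwise using (Pointwise; []; _∷_)
open import Data.List.Relation.Binary.Sublist.Propositional using (_⊆_)
open import Data.List.Relation.Unary.All using (All; []; _∷_)
open import Data.List.Relation.Unary.Any using (here)
open import Data.Nat.Base as ℕ using (ℕ; zero; suc; NonZero; _∸_; _⊓_; _≤_; _<_; _>_; z≤n; s≤s; s≤s⁻¹)
open import Data.Nat.Induction using (<-wellFounded)
open import Data.Nat.ListAction using (sum)
import Data.Nat.Properties as ℕ
import Data.Nat.Solver as ℕSolver
open import Data.Product.Base using (Σ-syntax; ∃-syntax; _×_; _,_; proj₁; proj₂)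
open import Function.Base using (_∘_; case_of_)
open import Function.Definitions using (Surjective)
open import Induction.WellFounded using (Acc; acc)
open import Level using (Level; _⊔_) renaming (suc to lsuc)
open import Relation.Binary.Definitions using (_Respects_)
open import Relation.Binary.PropositionalEquality as ≡
  using (_≡_; _≢_; refl; sym; trans; cong; cong₂; subst)
open import Relation.Nullary using (¬_; Dec; yes; no; recompute; ¬?; _×-dec_)
open import Relation.Unary using (Pred)

private
  variable
    c ℓ m m′ ℓm ℓm′ p : Level

record IsField (K : CommutativeRing c ℓ) : Set (c ⊔ ℓ) where
  open CommutativeRing K
  field
    1≉0        : ¬ 1# ≈ 0#
    invertible : ∀ x → ¬ x ≈ 0# → Invertible _≈_ 1# _*_ x

CharacteristicZero : CommutativeRing c ℓ → Set ℓ
CharacteristicZero K = ∀ n → ¬ (suc n · 1# ≈ 0#)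
  where
  open CommutativeRing K using (_≈_; 0#; 1#; +-rawMonoid)
  open RawMonoidDefinitions +-rawMonoid using () renaming (_×_ to infixr 8 _·_)

-- Inputs are numbered from 0: x ∘⟨ i ⟩ y grafts y onto input toℕ i + 1
-- in the usual numbering from 1.
record RawOperad (K : CommutativeRing c ℓ) m ℓm : Set (c ⊔ lsuc (m ⊔ ℓm)) where
  open CommutativeRing K using (Carrier)
  infixl 7 _∘⟨_⟩_
  infix 4 _≋_

  field
    component : ℕ → RawLeftModule Carrier m ℓm

  Op : ℕ → Set m
  Op n = RawLeftModule.Carrierᴹ (component n)

  field
    _∘⟨_⟩_ : ∀ {m n} → Op m → Fin m → Op n → Op (m ℕ.+ n ∸ 1)
    𝟏      : Op 1

  module _ {n : ℕ} where
    open RawLeftModule (component n) public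

  -- Equality of elements whose arities are equal but not definitionally so.
  _≋_ : ∀ {m n} → Op m → Op n → Set ℓm
  _≋_ {m} {n} x y = Σ[ eq ∈ m ≡ n ] subst Op eq x ≈ᴹ y

-- The arguments k and l below are the unique inputs with the stated values of
-- toℕ; they always exist.
record IsOperad {K : CommutativeRing c ℓ} (O : RawOperad K m ℓm) : Set (c ⊔ ℓ ⊔ m ⊔ ℓm) where
  open CommutativeRing K using (Carrier; ring)
  open RawOperad O
  field
    isLeftModule : ∀ n → IsLeftModule ring (_≈ᴹ_ {n}) _+ᴹ_ 0ᴹ -ᴹ_ _*ₗ_
    ∘-cong       : ∀ {m n} {x x′ : Op m} {y y′ : Op n} (i : Fin m) →
                   x ≈ᴹ x′ → y ≈ᴹ y′ → x ∘⟨ i ⟩ y ≈ᴹ x′ ∘⟨ i ⟩ y′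
    ∘-distribʳ   : ∀ {m n} (x x′ : Op m) (i : Fin m) (y : Op n) →
                   (x +ᴹ x′) ∘⟨ i ⟩ y ≈ᴹ x ∘⟨ i ⟩ y +ᴹ x′ ∘⟨ i ⟩ y
    ∘-distribˡ   : ∀ {m n} (x : Op m) (i : Fin m) (y y′ : Op n) →
                   x ∘⟨ i ⟩ (y +ᴹ y′) ≈ᴹ x ∘⟨ i ⟩ y +ᴹ x ∘⟨ i ⟩ y′
    ∘-*ₗˡ        : ∀ {m n} (a : Carrier) (x : Op m) (i : Fin m) (y : Op n) →
                   (a *ₗ x) ∘⟨ i ⟩ y ≈ᴹ a *ₗ (x ∘⟨ i ⟩ y)
    ∘-*ₗʳ        : ∀ {m n} (a : Carrier) (x : Op m) (i : Fin m) (y : Op n) →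
                   x ∘⟨ i ⟩ (a *ₗ y) ≈ᴹ a *ₗ (x ∘⟨ i ⟩ y)
    ∘-sequential : ∀ {m n p} (x : Op m) (i : Fin m) (y : Op n) (j : Fin n) (z : Op p)
                   (k : Fin (m ℕ.+ n ∸ 1)) → toℕ k ≡ toℕ i ℕ.+ toℕ j →
                   (x ∘⟨ i ⟩ y) ∘⟨ k ⟩ z ≋ x ∘⟨ i ⟩ (y ∘⟨ j ⟩ z)
    ∘-parallel   : ∀ {m n p} (x : Op m) (i j : Fin m) → i Fin.< j → (y : Op n) (z : Op p)
                   (k : Fin (m ℕ.+ n ∸ 1)) → toℕ k ≡ toℕ j ℕ.+ n ∸ 1 →
                   (l : Fin (m ℕ.+ p ∸ 1)) → toℕ l ≡ toℕ i →
                   (x ∘⟨ i ⟩ y) ∘⟨ k ⟩ z ≋ (x ∘⟨ j ⟩ z) ∘⟨ l ⟩ y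
    ∘-identityˡ  : ∀ {n} (x : Op n) → 𝟏 ∘⟨ zero ⟩ x ≈ᴹ x
    ∘-identityʳ  : ∀ {n} (x : Op n) (i : Fin n) → x ∘⟨ i ⟩ 𝟏 ≋ x

record Operad (K : CommutativeRing c ℓ) m ℓm : Set (c ⊔ ℓ ⊔ lsuc (m ⊔ ℓm)) where
  field
    rawOperad : RawOperad K m ℓm
    isOperad  : IsOperad rawOperad
  open RawOperad rawOperad public
  open IsOperad isOperad public

record IsOperadEpimorphism {K : CommutativeRing c ℓ}
                           (O : RawOperad K m ℓm) (P : RawOperad K m′ ℓm′)
                           (f : ∀ n → RawOperad.Op O n → RawOperad.Op P n) :
                           Set (c ⊔ m ⊔ m′ ⊔ ℓm ⊔ ℓm′) where
  private
    module O = RawOperad O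
    module P = RawOperad P
  open LeftModuleMorphisms using (IsLeftModuleHomomorphism)
  field
    isLeftModuleHomomorphism : ∀ n → IsLeftModuleHomomorphism (O.component n) (P.component n) (f n)
    ∘-homo     : ∀ {m n} (x : O.Op m) (i : Fin m) (y : O.Op n) →
                 f _ (x O.∘⟨ i ⟩ y) P.≈ᴹ f _ x P.∘⟨ i ⟩ f _ y
    𝟏-homo     : f 1 O.𝟏 P.≈ᴹ P.𝟏
    surjective : ∀ n → Surjective (O._≈ᴹ_ {n}) P._≈ᴹ_ (f n)

module _ {R : Set c} (M : RawLeftModule R m ℓm) where
  open RawLeftModule M

  record IsSubmodule (V : Pred Carrierᴹ p) : Set (c ⊔ m ⊔ ℓm ⊔ p) where
    field
      respects  : V Respects _≈ᴹ_
      0-closed  : V 0ᴹ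
      +-closed  : ∀ {x y} → V x → V y → V (x +ᴹ y)
      *ₗ-closed : ∀ a {x} → V x → V (a *ₗ x)

  linearCombination : List (R × Carrierᴹ) → Carrierᴹ
  linearCombination []             = 0ᴹ
  linearCombination ((a , x) ∷ xs) = a *ₗ x +ᴹ linearCombination xs

  Span : Pred Carrierᴹ p → Pred Carrierᴹ (c ⊔ m ⊔ ℓm ⊔ p)
  Span G x = ∃[ xs ] All (G ∘ proj₂) xs × x ≈ᴹ linearCombination xs

module _ {K : CommutativeRing c ℓ} (O : Operad K m ℓm) where
  open Operad O

  record IsOperadIdeal (V : ∀ n → Pred (Op n) p) : Set (c ⊔ m ⊔ ℓm ⊔ p) where
    field
      isSubmodule : ∀ n → IsSubmodule (component n) (V n)
      ∘-closedˡ   : ∀ {m n} {x : Op m} (i : Fin m) (y : Op n) → V m x → V _ (x ∘⟨ i ⟩ y)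
      ∘-closedʳ   : ∀ {m n} (x : Op m) (i : Fin m) {y : Op n} → V n y → V _ (x ∘⟨ i ⟩ y)

  -- The quotient has the elements and operations of O, with x and y
  -- identified when x - y lies in V.
  _/_ : (∀ n → Pred (Op n) p) → RawOperad K m p
  _/_ V = record
    { component = λ n → record
      { Carrierᴹ = Op n
      ; _≈ᴹ_     = λ x y → V n (x +ᴹ -ᴹ y)
      ; _+ᴹ_     = _+ᴹ_
      ; _*ₗ_     = _*ₗ_
      ; 0ᴹ       = 0ᴹ
      ; -ᴹ_      = -ᴹ_
      }
    ; _∘⟨_⟩_ = _∘⟨_⟩_
    ; 𝟏      = 𝟏
    }

RangeMap : Set
RangeMap = (i : ℕ) .{{_ : NonZero i}} → ℕ

Unimodal : RangeMap → Set
Unimodal δ = ∀ i₁ i₂ i₃ .{{_ : NonZero i₁}} .{{_ : NonZero i₂}} .{{_ : NonZero i₃}} →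
             i₁ < i₂ → i₂ < i₃ → ¬ (δ i₁ > δ i₂ × δ i₂ < δ i₃)

Word : Set
Word = List ℕ

infix 4 _≟_
_≟_ : (u v : Word) → Dec (u ≡ v)
_≟_ = ≡-dec ℕ._≟_

-- u □⟨ i ⟩ v is u □ᵢ₊₁ v in the numbering from 1.
_□⟨_⟩_ : Word → ℕ → Word → Word
u □⟨ i ⟩ v = take i u ++ v ++ drop i u

-- lookup and toℕ number letters from 0.
IsCliff : RangeMap → Word → Set
IsCliff δ w = ∀ i → lookup w i ≤ δ (suc (toℕ i))

isCliff? : ∀ δ w → Dec (IsCliff δ w)
isCliff? δ w = all? (λ i → lookup w i ℕ.≤? δ (suc (toℕ i)))

-- The δ-cliffs of size n; there are none of size 0.
record Cliff (δ : RangeMap) (n : ℕ) : Set where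
  constructor cliff
  field
    word     : Word
    .size    : suc (length word) ≡ n
    .isCliff : IsCliff δ word

open Cliff public using (word)

infix 4 _≼_ _≺_ _≼?_ _≺?_

_≼_ _≺_ : ∀ {δ n} → Cliff δ n → Cliff δ n → Set
u ≼ v = Pointwise _≤_ (word u) (word v)
u ≺ v = u ≼ v × word u ≢ word v

_≼?_ : ∀ {δ n} (u v : Cliff δ n) → Dec (u ≼ v)
u ≼? v = Pointwise.decidable ℕ._≤?_ (word u) (word v)

_≺?_ : ∀ {δ n} (u v : Cliff δ n) → Dec (u ≺ v)
u ≺? v = (u ≼? v) ×-dec ¬? (word u ≟ word v)

≺⇒sum< : ∀ {δ n} {u v : Cliff δ n} → u ≺ v → sum (word u) < sum (word v)
≺⇒sum< (u≼v , u≢v) = strict u≼v u≢v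
  where
  mono : ∀ {u v} → Pointwise _≤_ u v → sum u ≤ sum v
  mono []        = z≤n
  mono (a≤b ∷ r) = ℕ.+-mono-≤ a≤b (mono r)

  strict : ∀ {u v} → Pointwise _≤_ u v → u ≢ v → sum u < sum v
  strict []                        u≢v = ⊥-elim (u≢v refl)
  strict {a ∷ _} {b ∷ _} (a≤b ∷ r) u≢v with a ℕ.≟ b
  ... | yes refl = ℕ.+-monoʳ-< a (strict r (u≢v ∘ cong (a ∷_)))
  ... | no  a≢b  = ℕ.+-mono-<-≤ (ℕ.≤∧≢⇒< a≤b a≢b) (mono r)

module _ (δ : RangeMap) where

  reduction : (w : Word) → Cliff δ (suc (length w))
  reduction w = cliff (tabulate letter) (cong suc (length-tabulate letter))
                      (tabulate-bounded (λ i → δ (suc i)) letter (λ i → ℕ.m⊓n≤n (lookup w i) _))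
    where
    letter : Fin (length w) → ℕ
    letter i = lookup w i ⊓ δ (suc (toℕ i))

    tabulate-bounded : ∀ {n} (g : ℕ → ℕ) (f : Fin n → ℕ) → (∀ i → f i ≤ g (toℕ i)) →
                       ∀ i → lookup (tabulate f) i ≤ g (toℕ i)
    tabulate-bounded {suc n} g f f≤g zero    = f≤g zero
    tabulate-bounded {suc n} g f f≤g (suc i) = tabulate-bounded (g ∘ suc) (f ∘ suc) (f≤g ∘ suc) i

-- The words of length n whose letter number i, counted from 0, is at most g i.
boundedWords : (ℕ → ℕ) → ℕ → List Word
boundedWords g zero    = [] ∷ []
boundedWords g (suc n) = cartesianProductWith _∷_ (upTo (suc (g 0))) (boundedWords (g ∘ suc) n)

boundedWords-sound : ∀ g n {w} → w ∈ boundedWords g n →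
                     length w ≡ n × (∀ i → lookup w i ≤ g (toℕ i))
boundedWords-sound g zero    (here refl) = refl , λ ()
boundedWords-sound g (suc n) w∈
  with a , w , a∈ , w∈ , refl ← ∈-cartesianProductWith⁻ _∷_ (upTo (suc (g 0))) (boundedWords (g ∘ suc) n) w∈
  = let len , bnd = boundedWords-sound (g ∘ suc) n w∈ in
    cong suc len , λ { zero → s≤s⁻¹ (∈-upTo⁻ a∈) ; (suc i) → bnd i }

-- Every cliff of size n, exactly once.
cliffs : ∀ δ n → List (Cliff δ n)
cliffs δ zero    = []
cliffs δ (suc n) = mapWith∈ (boundedWords (λ i → δ (suc i)) n) λ {w} w∈ →
  cliff w (cong suc (proj₁ (boundedWords-sound _ n w∈))) (proj₂ (boundedWords-sound _ n w∈))

-- Letters that fit both before and after some position fit there too when δ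
-- is unimodal.  This is where associativity uses unimodality.
module _ {δ : RangeMap} where

  private
    Below : (ℕ → ℕ) → Word → Set
    Below g w = ∀ i → lookup w i ≤ g (toℕ i)

    At : ℕ → Word → Set
    At k = Below (λ j → δ (suc (k ℕ.+ j)))

    below-++⁻ : ∀ g u {v} → Below g (u ++ v) → Below g u × Below (λ j → g (length u ℕ.+ j)) v
    below-++⁻ g []      b = (λ ()) , b
    below-++⁻ g (x ∷ u) b = let bu , bv = below-++⁻ (g ∘ suc) u (b ∘ suc) in
      (λ { zero → b zero ; (suc i) → bu i }) , bv

    below-++⁺ : ∀ g u {v} → Below g u → Below (λ j → g (length u ℕ.+ j)) v → Below g (u ++ v)
    below-++⁺ g []      bu bv = bv
    below-++⁺ g (x ∷ u) bu bv zero    = bu zero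
    below-++⁺ g (x ∷ u) bu bv (suc i) = below-++⁺ (g ∘ suc) u (bu ∘ suc) bv i

    at-++⁻ : ∀ k u {v} → At k (u ++ v) → At k u × At (k ℕ.+ length u) v
    at-++⁻ k u {v} b = let bu , bv = below-++⁻ (λ j → δ (suc (k ℕ.+ j))) u b in
      bu , λ i → subst (λ t → lookup v i ≤ δ (suc t)) (sym (ℕ.+-assoc k (length u) (toℕ i))) (bv i)

    at-++⁺ : ∀ k u {v} → At k u → At (k ℕ.+ length u) v → At k (u ++ v)
    at-++⁺ k u {v} bu bv = below-++⁺ (λ j → δ (suc (k ℕ.+ j))) u bu
      λ i → subst (λ t → lookup v i ≤ δ (suc t)) (ℕ.+-assoc k (length u) (toℕ i)) (bv i)

  module _ (unimodal : Unimodal δ) where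

    private
      bound : ∀ {q r s a} → q ≤ r → r ≤ s → a ≤ δ (suc q) → a ≤ δ (suc s) → a ≤ δ (suc r)
      bound {q} {r} {s} {a} q≤r r≤s a≤q a≤s with a ℕ.≤? δ (suc r) | q ℕ.≟ r | r ℕ.≟ s
      ... | yes a≤r | _        | _        = a≤r
      ... | no _    | yes refl | _        = a≤q
      ... | no _    | no _     | yes refl = a≤s
      ... | no a≰r  | no q≢r   | no r≢s   = ⊥-elim
        (unimodal (suc q) (suc r) (suc s) (s≤s (ℕ.≤∧≢⇒< q≤r q≢r)) (s≤s (ℕ.≤∧≢⇒< r≤s r≢s))
          (ℕ.<-≤-trans (ℕ.≰⇒> a≰r) a≤q , ℕ.<-≤-trans (ℕ.≰⇒> a≰r) a≤s))

      between : ∀ {q r s} w → q ≤ r → r ≤ s → At q w → At s w → At r w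
      between w q≤r r≤s bq bs i =
        bound (ℕ.+-monoˡ-≤ (toℕ i) q≤r) (ℕ.+-monoˡ-≤ (toℕ i) r≤s) (bq i) (bs i)

    module _ (a b c d e : Word) (cliff-abcde : IsCliff δ (a ++ b ++ c ++ d ++ e)) where

      private
        A = length a
        B = length b
        C = length c
        D = length d
        a₀ = at-++⁻ 0 a cliff-abcde
        b₀ = at-++⁻ A b (proj₂ a₀)
        c₀ = at-++⁻ (A ℕ.+ B) c (proj₂ b₀)
        d₀ = at-++⁻ (A ℕ.+ B ℕ.+ C) d (proj₂ c₀)

        A≤AB : ∀ {k} → A ℕ.+ k ≤ A ℕ.+ B ℕ.+ k
        A≤AB {k} = ℕ.+-monoˡ-≤ k (ℕ.m≤m+n A B)
        AB≤ABC : ∀ {k} → A ℕ.+ B ℕ.+ k ≤ A ℕ.+ B ℕ.+ C ℕ.+ k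
        AB≤ABC {k} = ℕ.+-monoˡ-≤ k (ℕ.m≤m+n (A ℕ.+ B) C)

      cliff-abde : IsCliff δ (a ++ e) → IsCliff δ (b ++ d) → IsCliff δ (a ++ b ++ d ++ e)
      cliff-abde ae bd =
        at-++⁺ 0 a (proj₁ a₀)
          (at-++⁺ A b (proj₁ b₀)
            (at-++⁺ (A ℕ.+ B) d
              (between d (ℕ.m≤n+m B A) (ℕ.m≤m+n (A ℕ.+ B) C) (proj₂ (at-++⁻ 0 b bd)) (proj₁ d₀))
              (between e (ℕ.≤-trans (ℕ.m≤m+n A B) (ℕ.m≤m+n (A ℕ.+ B) D)) AB≤ABC (proj₂ (at-++⁻ 0 a ae)) (proj₂ d₀))))

      cliff-bcd : IsCliff δ (b ++ d) → IsCliff δ c → IsCliff δ (b ++ c ++ d)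
      cliff-bcd bd c′ =
        at-++⁺ 0 b (proj₁ (at-++⁻ 0 b bd))
          (at-++⁺ B c (between c z≤n (ℕ.m≤n+m B A) c′ (proj₁ c₀))
            (between d (ℕ.m≤m+n B C) (ℕ.+-monoˡ-≤ C (ℕ.m≤n+m B A)) (proj₂ (at-++⁻ 0 b bd)) (proj₁ d₀)))

      cliff-abce : IsCliff δ (a ++ c ++ e) → IsCliff δ (a ++ b ++ c ++ e)
      cliff-abce ace =
        at-++⁺ 0 a (proj₁ a₀)
          (at-++⁺ A b (proj₁ b₀)
            (at-++⁺ (A ℕ.+ B) c (proj₁ c₀)
              (between e A≤AB (ℕ.m≤m+n (A ℕ.+ B ℕ.+ C) D) (proj₂ (at-++⁻ A c (proj₂ (at-++⁻ 0 a ace)))) (proj₂ d₀))))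

      cliff-acde : IsCliff δ (a ++ c ++ e) → IsCliff δ d → IsCliff δ (a ++ c ++ d ++ e)
      cliff-acde ace d′ =
        at-++⁺ 0 a (proj₁ a₀)
          (at-++⁺ A c (proj₁ (at-++⁻ A c ce))
            (at-++⁺ (A ℕ.+ C) d (between d z≤n A≤AB d′ (proj₁ d₀))
              (between e (ℕ.m≤m+n (A ℕ.+ C) D) (ℕ.+-monoˡ-≤ D A≤AB) (proj₂ (at-++⁻ A c ce)) (proj₂ d₀))))
        where ce = proj₂ (at-++⁻ 0 a ace)

module _ (K : CommutativeRing c ℓ) where
  open CommutativeRing K using (Carrier; _≈_; _+_; _*_; -_; 0#; 1#)

  𝟙 : ∀ {P : Set} → Dec P → Carrier
  𝟙 (yes _) = 1#
  𝟙 (no  _) = 0#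

  module _ {δ : RangeMap} {n : ℕ} where

    -- A list of pairs (a , v) stands for the sum of the a · E_v.
    coefficient : Word → List (Carrier × Cliff δ n) → Carrier
    coefficient w []             = 0#
    coefficient w ((a , v) ∷ xs) = a * 𝟙 (word v ≟ w) + coefficient w xs

    scale : Carrier → List (Carrier × Cliff δ n) → List (Carrier × Cliff δ n)
    scale a = map λ (b , v) → a * b , v

    E : Cliff δ n → List (Carrier × Cliff δ n)
    E w = (1# , w) ∷ []

  freeModule : RangeMap → ℕ → RawLeftModule Carrier c ℓ
  freeModule δ n = record
    { Carrierᴹ = List (Carrier × Cliff δ n)
    ; _≈ᴹ_     = λ x y → (w : Cliff δ n) → coefficient (word w) x ≈ coefficient (word w) y
    ; _+ᴹ_     = _++_
    ; _*ₗ_     = scale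
    ; 0ᴹ       = []
    ; -ᴹ_      = scale (- 1#)
    }

  size-□ : ∀ {m n} u v i → suc (length u) ≡ m → suc (length v) ≡ n →
           suc (length (u □⟨ i ⟩ v)) ≡ m ℕ.+ n ∸ 1
  size-□ u v i refl refl = begin
    suc (length (take i u ++ v ++ drop i u))                  ≡⟨ cong suc (length-++ (take i u)) ⟩
    suc (length (take i u) ℕ.+ length (v ++ drop i u))        ≡⟨ cong (λ k → suc (length (take i u) ℕ.+ k)) (length-++ v) ⟩
    suc (length (take i u) ℕ.+ (length v ℕ.+ length (drop i u))) ≡⟨ cong suc (shuffle (length (take i u)) (length v) _) ⟩
    suc (length (take i u) ℕ.+ length (drop i u) ℕ.+ length v) ≡⟨ cong (λ k → suc (k ℕ.+ length v)) (length-++ (take i u)) ⟨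
    suc (length (take i u ++ drop i u) ℕ.+ length v)          ≡⟨ cong (λ w → suc (length w ℕ.+ length v)) (take++drop≡id i u) ⟩
    suc (length u ℕ.+ length v)                               ≡⟨ ℕ.+-suc (length u) (length v) ⟨
    length u ℕ.+ suc (length v)                               ∎
    where
    open ≡.≡-Reasoning
    shuffle : ∀ a b c → a ℕ.+ (b ℕ.+ c) ≡ a ℕ.+ c ℕ.+ b
    shuffle a b c = trans (cong (a ℕ.+_) (ℕ.+-comm b c)) (sym (ℕ.+-assoc a c b))

  circ : ∀ {δ m n} → Cliff δ m → Fin m → Cliff δ n → List (Carrier × Cliff δ (m ℕ.+ n ∸ 1))
  circ {δ} (cliff u su cu) i (cliff v sv cv) with isCliff? δ (u □⟨ toℕ i ⟩ v)
  ... | yes cuv = E (cliff (u □⟨ toℕ i ⟩ v) (size-□ u v (toℕ i) su sv) cuv)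
  ... | no  _   = []

  compose : ∀ {δ m n} → List (Carrier × Cliff δ m) → Fin m → List (Carrier × Cliff δ n) →
            List (Carrier × Cliff δ (m ℕ.+ n ∸ 1))
  compose x i y = concatMap (λ (a , u) → concatMap (λ (b , v) → scale (a * b) (circ u i v)) y) x

  cliffRawOperad : RangeMap → RawOperad K c ℓ
  cliffRawOperad δ = record
    { component = freeModule δ
    ; _∘⟨_⟩_    = compose
    ; 𝟏         = E (cliff [] refl λ ())
    }

  𝟙-yes : ∀ {P : Set} (d : Dec P) → P → 𝟙 d ≡ 1#
  𝟙-yes (yes _) _ = refl
  𝟙-yes (no ¬p) p = ⊥-elim (¬p p)

  𝟙-no : ∀ {P : Set} (d : Dec P) → ¬ P → 𝟙 d ≡ 0#
  𝟙-no (yes p) ¬p = ⊥-elim (¬p p)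
  𝟙-no (no _)  _  = refl

  private
    module K = CommutativeRing K
    module KP = RingProperties K.ring
    open import Relation.Binary.Reasoning.Setoid K.setoid

    open SemiringSolver K.commutativeSemiring using (solve; _:=_; _:+_; _:*_; con)

  module _ {δ : RangeMap} {n : ℕ} where

    coefficient-++ : ∀ w (x y : List (Carrier × Cliff δ n)) →
                     coefficient w (x ++ y) ≈ coefficient w x + coefficient w y
    coefficient-++ w []            y = K.sym (K.+-identityˡ _)
    coefficient-++ w ((a , v) ∷ x) y =
      K.trans (K.+-congˡ (coefficient-++ w x y)) (K.sym (K.+-assoc _ _ _))

    coefficient-scale : ∀ w a (x : List (Carrier × Cliff δ n)) →
                        coefficient w (scale a x) ≈ a * coefficient w x
    coefficient-scale w a []            = K.sym (K.zeroʳ a)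
    coefficient-scale w a ((b , v) ∷ x) = begin
      (a * b) * 𝟙 (word v ≟ w) + coefficient w (scale a x)  ≈⟨ K.+-cong (K.*-assoc _ _ _) (coefficient-scale w a x) ⟩
      a * (b * 𝟙 (word v ≟ w)) + a * coefficient w x        ≈⟨ K.distribˡ _ _ _ ⟨
      a * (b * 𝟙 (word v ≟ w) + coefficient w x)            ∎

    coefficient-E : ∀ w (v : Cliff δ n) → coefficient w (E v) ≈ 𝟙 (word v ≟ w)
    coefficient-E w v = K.trans (K.+-identityʳ _) (K.*-identityˡ _)

    size≡ : (v : Cliff δ n) → suc (length (word v)) ≡ n
    size≡ (cliff u s _) = recompute (suc (length u) ℕ.≟ n) s

    isCliff : (v : Cliff δ n) → IsCliff δ (word v)
    isCliff (cliff u _ c) = recompute (isCliff? δ u) c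

    coefficient≈0 : ∀ w (x : List (Carrier × Cliff δ n)) →
                    (∀ (v : Cliff δ n) → word v ≢ w) → coefficient w x ≈ 0#
    coefficient≈0 w []            v≢w = K.refl
    coefficient≈0 w ((a , v) ∷ x) v≢w = begin
      a * 𝟙 (word v ≟ w) + coefficient w x  ≈⟨ K.+-cong (K.*-congˡ (K.reflexive (𝟙-no (word v ≟ w) (v≢w v)))) (coefficient≈0 w x v≢w) ⟩
      a * 0# + 0#                           ≈⟨ K.+-cong (K.zeroʳ a) K.refl ⟩
      0# + 0#                               ≈⟨ K.+-identityˡ 0# ⟩
      0#                                    ∎

    coefficient≈0-¬cliff : ∀ w (x : List (Carrier × Cliff δ n)) → ¬ IsCliff δ w → coefficient w x ≈ 0#
    coefficient≈0-¬cliff w x ¬c = coefficient≈0 w x λ v v≡w → ¬c (subst (IsCliff δ) v≡w (isCliff v))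

    coefficient-cong : ∀ w {x y : List (Carrier × Cliff δ n)} →
                       (∀ (v : Cliff δ n) → coefficient (word v) x ≈ coefficient (word v) y) →
                       coefficient w x ≈ coefficient w y
    coefficient-cong w {x} {y} x≈y with suc (length w) ℕ.≟ n | isCliff? δ w
    ... | yes s | yes c = x≈y (cliff w s c)
    ... | no ¬s | _     = K.trans (coefficient≈0 w x ≢w) (K.sym (coefficient≈0 w y ≢w))
      where
      ≢w : ∀ (v : Cliff δ n) → word v ≢ w
      ≢w v v≡w = ¬s (subst (λ u → suc (length u) ≡ n) v≡w (size≡ v))
    ... | _     | no ¬c = K.trans (coefficient≈0-¬cliff w x ¬c) (K.sym (coefficient≈0-¬cliff w y ¬c))

  coefficient-subst : ∀ {δ m n} w (eq : m ≡ n) (x : List (Carrier × Cliff δ m)) →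
                      coefficient w (subst (λ k → List (Carrier × Cliff δ k)) eq x) ≡ coefficient w x
  coefficient-subst w refl x = refl

  freeModule-isLeftModule : ∀ δ n → let open RawLeftModule (freeModule δ n) in
                            IsLeftModule K.ring _≈ᴹ_ _+ᴹ_ 0ᴹ -ᴹ_ _*ₗ_
  freeModule-isLeftModule δ n = record
    { isLeftSemimodule = record
      { +ᴹ-isCommutativeMonoid = record
        { isMonoid = record
          { isSemigroup = record
            { isMagma = record
              { isEquivalence = record
                { refl  = λ _ → K.refl
                ; sym   = λ p w → K.sym (p w)
                ; trans = λ p q w → K.trans (p w) (q w)
                }
              ; ∙-cong = λ {x} {y} {u} {v} → +-cong {x} {y} {u} {v}
              }
            ; assoc = λ x y z w → K.reflexive (cong (coefficient (word w)) (++-assoc x y z))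
            }
          ; identity = (λ _ _ → K.refl) , λ x w → K.reflexive (cong (coefficient (word w)) (++-identityʳ x))
          }
        ; comm = comm
        }
      ; isPreleftSemimodule = record
        { *ₗ-cong      = λ {a} {b} {x} {y} a≈b x≈y w →
            K.trans (coefficient-scale _ a x) (K.trans (K.*-cong a≈b (x≈y w)) (K.sym (coefficient-scale _ b y)))
        ; *ₗ-zeroˡ     = λ x w → K.trans (coefficient-scale _ 0# x) (K.zeroˡ _)
        ; *ₗ-distribʳ  = λ x a b w → begin
            coefficient (word w) (scale (a + b) x)                                    ≈⟨ coefficient-scale _ (a + b) x ⟩
            (a + b) * coefficient (word w) x                                          ≈⟨ K.distribʳ _ a b ⟩
            a * coefficient (word w) x + b * coefficient (word w) x                   ≈⟨ K.+-cong (coefficient-scale _ a x) (coefficient-scale _ b x) ⟨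
            coefficient (word w) (scale a x) + coefficient (word w) (scale b x)       ≈⟨ coefficient-++ _ (scale a x) (scale b x) ⟨
            coefficient (word w) (scale a x ++ scale b x)                             ∎
        ; *ₗ-identityˡ = λ x w → K.trans (coefficient-scale _ 1# x) (K.*-identityˡ _)
        ; *ₗ-assoc     = λ a b x w → begin
            coefficient (word w) (scale (a * b) x)          ≈⟨ coefficient-scale _ (a * b) x ⟩
            (a * b) * coefficient (word w) x                ≈⟨ K.*-assoc a b _ ⟩
            a * (b * coefficient (word w) x)                ≈⟨ K.*-congˡ (coefficient-scale _ b x) ⟨
            a * coefficient (word w) (scale b x)            ≈⟨ coefficient-scale _ a (scale b x) ⟨
            coefficient (word w) (scale a (scale b x))      ∎
        ; *ₗ-zeroʳ     = λ _ _ → K.refl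
        ; *ₗ-distribˡ  = λ a x y w → begin
            coefficient (word w) (scale a (x ++ y))                                   ≈⟨ coefficient-scale _ a (x ++ y) ⟩
            a * coefficient (word w) (x ++ y)                                         ≈⟨ K.*-congˡ (coefficient-++ _ x y) ⟩
            a * (coefficient (word w) x + coefficient (word w) y)                     ≈⟨ K.distribˡ a _ _ ⟩
            a * coefficient (word w) x + a * coefficient (word w) y                   ≈⟨ K.+-cong (coefficient-scale _ a x) (coefficient-scale _ a y) ⟨
            coefficient (word w) (scale a x) + coefficient (word w) (scale a y)       ≈⟨ coefficient-++ _ (scale a x) (scale a y) ⟨
            coefficient (word w) (scale a x ++ scale a y)                             ∎
        }
      }
    ; -ᴹ‿cong    = λ {x} {y} x≈y w →
        K.trans (coefficient-scale _ _ x) (K.trans (K.*-congˡ (x≈y w)) (K.sym (coefficient-scale _ _ y)))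
    ; -ᴹ‿inverse = inverseˡ , λ x w → K.trans (comm x (scale (- 1#) x) w) (inverseˡ x w)
    }
    where
    open RawLeftModule (freeModule δ n)

    +-cong : ∀ {x y u v} → x ≈ᴹ y → u ≈ᴹ v → x ++ u ≈ᴹ y ++ v
    +-cong {x} {y} {u} {v} x≈y u≈v w = begin
      coefficient (word w) (x ++ u)                        ≈⟨ coefficient-++ _ x u ⟩
      coefficient (word w) x + coefficient (word w) u      ≈⟨ K.+-cong (x≈y w) (u≈v w) ⟩
      coefficient (word w) y + coefficient (word w) v      ≈⟨ coefficient-++ _ y v ⟨
      coefficient (word w) (y ++ v)                        ∎

    comm : ∀ x y → x ++ y ≈ᴹ y ++ x
    comm x y w = begin
      coefficient (word w) (x ++ y)                        ≈⟨ coefficient-++ _ x y ⟩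
      coefficient (word w) x + coefficient (word w) y      ≈⟨ K.+-comm _ _ ⟩
      coefficient (word w) y + coefficient (word w) x      ≈⟨ coefficient-++ _ y x ⟨
      coefficient (word w) (y ++ x)                        ∎

    inverseˡ : ∀ x → scale (- 1#) x ++ x ≈ᴹ []
    inverseˡ x w = begin
      coefficient (word w) (scale (- 1#) x ++ x)                        ≈⟨ coefficient-++ _ (scale (- 1#) x) x ⟩
      coefficient (word w) (scale (- 1#) x) + coefficient (word w) x    ≈⟨ K.+-congʳ (coefficient-scale _ (- 1#) x) ⟩
      - 1# * coefficient (word w) x + coefficient (word w) x            ≈⟨ K.+-congʳ (KP.-1*x≈-x _) ⟩
      - coefficient (word w) x + coefficient (word w) x                 ≈⟨ K.-‿inverseˡ _ ⟩
      0#                                                                ∎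

  private
    ++-injective-length : ∀ (u u′ : Word) {v v′} → length u ≡ length u′ → u ++ v ≡ u′ ++ v′ → u ≡ u′ × v ≡ v′
    ++-injective-length []      []        _   eq = refl , eq
    ++-injective-length (x ∷ u) (x′ ∷ u′) len eq with ∷-injective eq
    ... | refl , eq′ with ++-injective-length u u′ (ℕ.suc-injective len) eq′
    ... | refl , eq″ = refl , eq″

    take-length : ∀ (a : Word) {c} → take (length a) (a ++ c) ≡ a
    take-length []      = refl
    take-length (x ∷ a) = cong (x ∷_) (take-length a)

    drop-length : ∀ (a : Word) {c} → drop (length a) (a ++ c) ≡ c
    drop-length []      = refl
    drop-length (x ∷ a) = drop-length a

    □-++ : ∀ a b c → (a ++ c) □⟨ length a ⟩ b ≡ a ++ b ++ c
    □-++ a b c = cong₂ (λ s t → s ++ b ++ t) (take-length a) (drop-length a)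

    □-++⁻ : ∀ u v a b c → length a ≤ length u → length v ≡ length b →
            u □⟨ length a ⟩ v ≡ a ++ b ++ c → u ≡ a ++ c × v ≡ b
    □-++⁻ u v a b c a≤u v≡b eq
      with ++-injective-length (take (length a) u) a (trans (length-take (length a) u) (ℕ.m≤n⇒m⊓n≡m a≤u)) eq
    ... | t≡a , eq′ with ++-injective-length v b v≡b eq′
    ... | refl , d≡c = trans (sym (take++drop≡id (length a) u)) (cong₂ _++_ t≡a d≡c) , refl

    open ℕSolver.+-*-Solver using () renaming (solve to ℕ-solve; _:=_ to _⊜_; _:+_ to _⊕_; con to κ)

    ≤⇒∃+ : ∀ {a b} → a ≤ b → ∃[ d ] b ≡ a ℕ.+ d
    ≤⇒∃+ {a} {b} a≤b = b ∸ a , sym (ℕ.m+[n∸m]≡n a≤b)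

    split : ∀ {k r} (w : Word) → length w ≡ k ℕ.+ r → ∃[ a ] ∃[ b ] w ≡ a ++ b × length a ≡ k × length b ≡ r
    split {zero}  w       eq = [] , w , refl , refl , eq
    split {suc k} (x ∷ w) eq = let a , b , w≡ , a≡ , b≡ = split w (ℕ.suc-injective eq) in
      x ∷ a , b , cong (x ∷_) w≡ , cong suc a≡ , b≡

    split₅ : ∀ {k₁ k₂ k₃ k₄ k₅} (w : Word) → length w ≡ k₁ ℕ.+ (k₂ ℕ.+ (k₃ ℕ.+ (k₄ ℕ.+ k₅))) →
             ∃[ a ] ∃[ b ] ∃[ c ] ∃[ d ] ∃[ e ] w ≡ a ++ b ++ c ++ d ++ e ×
             length a ≡ k₁ × length b ≡ k₂ × length c ≡ k₃ × length d ≡ k₄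
    split₅ w eq
      with a , w₁ , refl , a≡ , eq ← split w eq
      with b , w₂ , refl , b≡ , eq ← split w₁ eq
      with c , w₃ , refl , c≡ , eq ← split w₂ eq
      with d , e  , refl , d≡ , _  ← split w₃ eq
      = a , b , c , d , e , refl , a≡ , b≡ , c≡ , d≡

  -- The composition in coordinates.  A word of the form a b c, with a ending
  -- where the composition at i inserts its second argument, arises only from
  -- a c and b.
  coefficient-circ-□ : ∀ {δ m n} w (u : Cliff δ m) (i : Fin m) (v : Cliff δ n) → coefficient w (circ u i v) ≈
                       𝟙 (isCliff? δ (word u □⟨ toℕ i ⟩ word v)) * 𝟙 ((word u □⟨ toℕ i ⟩ word v) ≟ w)
  coefficient-circ-□ {δ} w (cliff u _ _) i (cliff v _ _) with isCliff? δ (u □⟨ toℕ i ⟩ v)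
  ... | yes _ = K.+-identityʳ _
  ... | no  _ = K.sym (K.zeroˡ _)

  module _ {δ : RangeMap} {m n : ℕ} (i : Fin m) (a b c : Word)
           (a≡i : length a ≡ toℕ i) (b≡n : length b ≡ n ∸ 1) where

    private
      w  = a ++ b ++ c
      ac = a ++ c

    coefficient-circ-≢ : ∀ (u : Cliff δ m) (v : Cliff δ n) → ¬ (word u ≡ ac × word v ≡ b) →
                         coefficient w (circ u i v) ≈ 0#
    coefficient-circ-≢ u v ¬uv = begin
      coefficient w (circ u i v)                        ≈⟨ coefficient-circ-□ w u i v ⟩
      𝟙 (isCliff? δ uv) * 𝟙 (uv ≟ w)                    ≡⟨ cong (𝟙 (isCliff? δ uv) *_) (𝟙-no (uv ≟ w) uv≢w) ⟩
      𝟙 (isCliff? δ uv) * 0#                            ≈⟨ K.zeroʳ _ ⟩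
      0#                                                ∎
      where
      uv = word u □⟨ toℕ i ⟩ word v
      uv≢w : uv ≢ w
      uv≢w uv≡w = ¬uv (□-++⁻ (word u) (word v) a b c
        (ℕ.≤-trans (ℕ.≤-reflexive a≡i) (s≤s⁻¹ (subst (toℕ i <_) (sym (size≡ u)) (toℕ<n i))))
        (trans (cong (_∸ 1) (size≡ v)) (sym b≡n))
        (subst (λ k → word u □⟨ k ⟩ word v ≡ w) (sym a≡i) uv≡w))

    coefficient-circ : ∀ (u : Cliff δ m) (v : Cliff δ n) → coefficient w (circ u i v) ≈
                       𝟙 (isCliff? δ w) * (𝟙 (word u ≟ ac) * 𝟙 (word v ≟ b))
    coefficient-circ u v with word u ≟ ac | word v ≟ b
    ... | yes u≡ac | yes v≡b = begin
      coefficient w (circ u i v)                        ≈⟨ coefficient-circ-□ w u i v ⟩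
      𝟙 (isCliff? δ uv) * 𝟙 (uv ≟ w)                    ≡⟨ cong (λ z → 𝟙 (isCliff? δ z) * 𝟙 (z ≟ w)) uv≡w ⟩
      𝟙 (isCliff? δ w) * 𝟙 (w ≟ w)                      ≡⟨ cong (𝟙 (isCliff? δ w) *_) (𝟙-yes (w ≟ w) refl) ⟩
      𝟙 (isCliff? δ w) * 1#                             ≈⟨ K.*-congˡ (K.*-identityˡ 1#) ⟨
      𝟙 (isCliff? δ w) * (1# * 1#)                      ∎
      where
      uv   = word u □⟨ toℕ i ⟩ word v
      uv≡w : uv ≡ w
      uv≡w = trans (cong₂ (_□⟨ toℕ i ⟩_) u≡ac v≡b)
                   (subst (λ k → ac □⟨ k ⟩ b ≡ w) a≡i (□-++ a b c))
    ... | yes _ | no v≢b = begin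
      coefficient w (circ u i v)                        ≈⟨ coefficient-circ-≢ u v (v≢b ∘ proj₂) ⟩
      0#                                                ≈⟨ K.zeroʳ _ ⟨
      𝟙 (isCliff? δ w) * 0#                             ≈⟨ K.*-congˡ (K.zeroʳ 1#) ⟨
      𝟙 (isCliff? δ w) * (1# * 0#)                      ∎
    ... | no u≢ac | e = begin
      coefficient w (circ u i v)                        ≈⟨ coefficient-circ-≢ u v (u≢ac ∘ proj₁) ⟩
      0#                                                ≈⟨ K.zeroʳ _ ⟨
      𝟙 (isCliff? δ w) * 0#                             ≈⟨ K.*-congˡ (K.zeroˡ _) ⟨
      𝟙 (isCliff? δ w) * (0# * 𝟙 e)                     ∎

    coefficient-∘ : ∀ (x : List (Carrier × Cliff δ m)) (y : List (Carrier × Cliff δ n)) →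
                    coefficient w (compose x i y) ≈
                    𝟙 (isCliff? δ w) * (coefficient ac x * coefficient b y)
    coefficient-∘ []            y = K.sym (K.trans (K.*-congˡ (K.zeroˡ _)) (K.zeroʳ _))
    coefficient-∘ ((r , u) ∷ x) y = begin
      coefficient w (concatMap (λ (s , v) → scale (r * s) (circ u i v)) y ++ _)
        ≈⟨ coefficient-++ w (concatMap (λ (s , v) → scale (r * s) (circ u i v)) y) _ ⟩
      coefficient w (concatMap (λ (s , v) → scale (r * s) (circ u i v)) y) + coefficient w (compose x i y)
        ≈⟨ K.+-cong (row y) (coefficient-∘ x y) ⟩
      r * (t * (e * Y)) + t * (X * Y)
        ≈⟨ solve 5 (λ r t e X Y → r :* (t :* (e :* Y)) :+ t :* (X :* Y) := t :* ((r :* e :+ X) :* Y)) K.refl r t e X Y ⟩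
      t * ((r * e + X) * Y)  ∎
      where
      t = 𝟙 (isCliff? δ w)
      e = 𝟙 (word u ≟ ac)
      X = coefficient ac x
      Y = coefficient b y

      row : ∀ y → coefficient w (concatMap (λ (s , v) → scale (r * s) (circ u i v)) y) ≈
            r * (t * (e * coefficient b y))
      row []            = solve 3 (λ r t e → con 0 := r :* (t :* (e :* con 0))) K.refl r t e
      row ((s , v) ∷ y) = begin
        coefficient w (scale (r * s) (circ u i v) ++ _)
          ≈⟨ coefficient-++ w (scale (r * s) (circ u i v)) _ ⟩
        coefficient w (scale (r * s) (circ u i v)) + coefficient w (concatMap (λ (s , v) → scale (r * s) (circ u i v)) y)
          ≈⟨ K.+-cong (coefficient-scale w (r * s) (circ u i v)) (row y) ⟩
        (r * s) * coefficient w (circ u i v) + r * (t * (e * coefficient b y))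
          ≈⟨ K.+-congʳ (K.*-congˡ (coefficient-circ u v)) ⟩
        (r * s) * (t * (e * 𝟙 (word v ≟ b))) + r * (t * (e * coefficient b y))
          ≈⟨ solve 6 (λ r s t e q Z → (r :* s) :* (t :* (e :* q)) :+ r :* (t :* (e :* Z)) := r :* (t :* (e :* (s :* q :+ Z))))
                     K.refl r s t e (𝟙 (word v ≟ b)) (coefficient b y) ⟩
        r * (t * (e * (s * 𝟙 (word v ≟ b) + coefficient b y)))  ∎

  compose-zeroʳ : ∀ {δ m n} (x : List (Carrier × Cliff δ m)) (i : Fin m) → compose {n = n} x i [] ≡ []
  compose-zeroʳ []      i = refl
  compose-zeroʳ (_ ∷ x) i = compose-zeroʳ x i

  arity-zero : ∀ {δ} (x : List (Carrier × Cliff δ 0)) → x ≡ []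
  arity-zero []            = refl
  arity-zero ((_ , v) ∷ _) with () ← size≡ v

  module _ {δ : RangeMap} where

    private
      FM : ℕ → Set c
      FM n = List (Carrier × Cliff δ n)

      1⟨_⟩ : Word → Carrier
      1⟨ w ⟩ = 𝟙 (isCliff? δ w)

    -- Two cliff conditions agree once multiplied by the coefficients of the
    -- three arguments, if they agree when those are taken at cliffs.
    indicators-agree : ∀ {m n p} (x : FM m) (y : FM n) (z : FM p) u v w s t →
      (IsCliff δ u → IsCliff δ v → IsCliff δ w → IsCliff δ s × IsCliff δ t) →
      1⟨ s ⟩ * (coefficient u x * (coefficient v y * coefficient w z)) ≈
      1⟨ t ⟩ * (coefficient u x * (coefficient v y * coefficient w z))
    indicators-agree x y z u v w s t agree with isCliff? δ u | isCliff? δ v | isCliff? δ w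
    ... | yes cu | yes cv | yes cw = let cs , ct = agree cu cv cw in
      K.*-congʳ (K.reflexive (trans (𝟙-yes (isCliff? δ s) cs) (sym (𝟙-yes (isCliff? δ t) ct))))
    ... | no ¬cu | _ | _ = K.trans (vanish _) (K.sym (vanish _))
      where
      vanish : ∀ r → r * (coefficient u x * (coefficient v y * coefficient w z)) ≈ 0#
      vanish r = K.trans (K.*-congˡ (K.trans (K.*-congʳ (coefficient≈0-¬cliff u x ¬cu)) (K.zeroˡ _))) (K.zeroʳ r)
    ... | yes _ | no ¬cv | _ = K.trans (vanish _) (K.sym (vanish _))
      where
      vanish : ∀ r → r * (coefficient u x * (coefficient v y * coefficient w z)) ≈ 0#
      vanish r = K.trans (K.*-congˡ (K.trans (K.*-congˡ (K.trans (K.*-congʳ (coefficient≈0-¬cliff v y ¬cv)) (K.zeroˡ _))) (K.zeroʳ _))) (K.zeroʳ r)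
    ... | yes _ | yes _ | no ¬cw = K.trans (vanish _) (K.sym (vanish _))
      where
      vanish : ∀ r → r * (coefficient u x * (coefficient v y * coefficient w z)) ≈ 0#
      vanish r = K.trans (K.*-congˡ (K.trans (K.*-congˡ (K.trans (K.*-congˡ (coefficient≈0-¬cliff w z ¬cw)) (K.zeroʳ _))) (K.zeroʳ _))) (K.zeroʳ r)

    module _ (unimodal : Unimodal δ) (a b c d e : Word) (cliff-abcde : IsCliff δ (a ++ b ++ c ++ d ++ e)) where

      private
        w = a ++ b ++ c ++ d ++ e

      coefficient-sequential :
        ∀ {m n p} (x : FM m) (i : Fin m) (y : FM n) (j : Fin n) (z : FM p) (k : Fin (m ℕ.+ n ∸ 1)) →
        length a ≡ toℕ i → length b ≡ toℕ j → length c ≡ p ∸ 1 →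
        length (b ++ d) ≡ n ∸ 1 → length (a ++ b) ≡ toℕ k → length (b ++ c ++ d) ≡ n ℕ.+ p ∸ 1 ∸ 1 →
        coefficient w (compose (compose x i y) k z) ≈ coefficient w (compose x i (compose y j z))
      coefficient-sequential x i y j z k a≡i b≡j c≡p bd≡n ab≡k bcd≡np = begin
        coefficient w (compose (compose x i y) k z)
          ≡⟨ cong (λ w → coefficient w (compose (compose x i y) k z)) (++-assoc a b (c ++ d ++ e)) ⟨
        coefficient ((a ++ b) ++ c ++ d ++ e) (compose (compose x i y) k z)
          ≈⟨ coefficient-∘ k (a ++ b) c (d ++ e) ab≡k c≡p (compose x i y) z ⟩
        1⟨ (a ++ b) ++ c ++ d ++ e ⟩ * (coefficient ((a ++ b) ++ d ++ e) (compose x i y) * Z)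
          ≡⟨ cong₂ (λ s t → 1⟨ s ⟩ * (coefficient t (compose x i y) * Z)) (++-assoc a b (c ++ d ++ e))
                   (trans (++-assoc a b (d ++ e)) (cong (a ++_) (sym (++-assoc b d e)))) ⟩
        1⟨ w ⟩ * (coefficient (a ++ (b ++ d) ++ e) (compose x i y) * Z)
          ≈⟨ K.*-congˡ (K.*-congʳ (coefficient-∘ i a (b ++ d) e a≡i bd≡n x y)) ⟩
        1⟨ w ⟩ * ((1⟨ a ++ (b ++ d) ++ e ⟩ * (X * Y)) * Z)
          ≈⟨ solve 5 (λ r s X Y Z → r :* ((s :* (X :* Y)) :* Z) := r :* (s :* (X :* (Y :* Z)))) K.refl
                   1⟨ w ⟩ 1⟨ a ++ (b ++ d) ++ e ⟩ X Y Z ⟩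
        1⟨ w ⟩ * (1⟨ a ++ (b ++ d) ++ e ⟩ * (X * (Y * Z)))
          ≈⟨ K.*-congˡ (indicators-agree x y z (a ++ e) (b ++ d) c (a ++ (b ++ d) ++ e) (b ++ c ++ d) agree) ⟩
        1⟨ w ⟩ * (1⟨ b ++ c ++ d ⟩ * (X * (Y * Z)))
          ≈⟨ solve 5 (λ r s X Y Z → r :* (s :* (X :* (Y :* Z))) := r :* (X :* (s :* (Y :* Z)))) K.refl
                   1⟨ w ⟩ 1⟨ b ++ c ++ d ⟩ X Y Z ⟩
        1⟨ w ⟩ * (X * (1⟨ b ++ c ++ d ⟩ * (Y * Z)))
          ≈⟨ K.*-congˡ (K.*-congˡ (coefficient-∘ j b c d b≡j c≡p y z)) ⟨
        1⟨ w ⟩ * (X * coefficient (b ++ c ++ d) (compose y j z))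
          ≡⟨ cong (λ s → 1⟨ s ⟩ * (X * coefficient (b ++ c ++ d) (compose y j z))) w≡ ⟨
        1⟨ a ++ (b ++ c ++ d) ++ e ⟩ * (X * coefficient (b ++ c ++ d) (compose y j z))
          ≈⟨ coefficient-∘ i a (b ++ c ++ d) e a≡i bcd≡np x (compose y j z) ⟨
        coefficient (a ++ (b ++ c ++ d) ++ e) (compose x i (compose y j z))
          ≡⟨ cong (λ s → coefficient s (compose x i (compose y j z))) w≡ ⟩
        coefficient w (compose x i (compose y j z))  ∎
        where
        X = coefficient (a ++ e) x
        Y = coefficient (b ++ d) y
        Z = coefficient c z

        w≡ : a ++ (b ++ c ++ d) ++ e ≡ w
        w≡ = cong (a ++_) (trans (++-assoc b (c ++ d) e) (cong (b ++_) (++-assoc c d e)))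

        agree : IsCliff δ (a ++ e) → IsCliff δ (b ++ d) → IsCliff δ c →
                IsCliff δ (a ++ (b ++ d) ++ e) × IsCliff δ (b ++ c ++ d)
        agree ae bd c′ =
          subst (IsCliff δ) (cong (a ++_) (sym (++-assoc b d e))) (cliff-abde unimodal a b c d e cliff-abcde ae bd) ,
          cliff-bcd unimodal a b c d e cliff-abcde bd c′

      coefficient-parallel :
        ∀ {m n p} (x : FM m) (i j : Fin m) (y : FM n) (z : FM p)
        (k : Fin (m ℕ.+ n ∸ 1)) (l : Fin (m ℕ.+ p ∸ 1)) →
        length a ≡ toℕ i → length a ≡ toℕ l → length b ≡ n ∸ 1 → length (a ++ c) ≡ toℕ j → length d ≡ p ∸ 1 →
        length (a ++ b ++ c) ≡ toℕ k →
        coefficient w (compose (compose x i y) k z) ≈ coefficient w (compose (compose x j z) l y)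
      coefficient-parallel x i j y z k l a≡i a≡l b≡n ac≡j d≡p abc≡k = begin
        coefficient w (compose (compose x i y) k z)
          ≡⟨ cong (λ w → coefficient w (compose (compose x i y) k z)) (w≡ (d ++ e)) ⟨
        coefficient ((a ++ b ++ c) ++ d ++ e) (compose (compose x i y) k z)
          ≈⟨ coefficient-∘ k (a ++ b ++ c) d e abc≡k d≡p (compose x i y) z ⟩
        1⟨ (a ++ b ++ c) ++ d ++ e ⟩ * (coefficient ((a ++ b ++ c) ++ e) (compose x i y) * Z)
          ≡⟨ cong₂ (λ s t → 1⟨ s ⟩ * (coefficient t (compose x i y) * Z)) (w≡ (d ++ e)) (w≡ e) ⟩
        1⟨ w ⟩ * (coefficient (a ++ b ++ c ++ e) (compose x i y) * Z)
          ≈⟨ K.*-congˡ (K.*-congʳ (coefficient-∘ i a b (c ++ e) a≡i b≡n x y)) ⟩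
        1⟨ w ⟩ * ((1⟨ a ++ b ++ c ++ e ⟩ * (X * Y)) * Z)
          ≈⟨ solve 5 (λ r s X Y Z → r :* ((s :* (X :* Y)) :* Z) := r :* (s :* (X :* (Y :* Z)))) K.refl
                   1⟨ w ⟩ 1⟨ a ++ b ++ c ++ e ⟩ X Y Z ⟩
        1⟨ w ⟩ * (1⟨ a ++ b ++ c ++ e ⟩ * (X * (Y * Z)))
          ≈⟨ K.*-congˡ (indicators-agree x y z (a ++ c ++ e) b d (a ++ b ++ c ++ e) (a ++ c ++ d ++ e)
                          λ ace _ d′ → cliff-abce unimodal a b c d e cliff-abcde ace ,
                                       cliff-acde unimodal a b c d e cliff-abcde ace d′) ⟩
        1⟨ w ⟩ * (1⟨ a ++ c ++ d ++ e ⟩ * (X * (Y * Z)))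
          ≈⟨ solve 5 (λ r s X Y Z → r :* (s :* (X :* (Y :* Z))) := r :* ((s :* (X :* Z)) :* Y)) K.refl
                   1⟨ w ⟩ 1⟨ a ++ c ++ d ++ e ⟩ X Y Z ⟩
        1⟨ w ⟩ * ((1⟨ a ++ c ++ d ++ e ⟩ * (X * Z)) * Y)
          ≡⟨ cong₂ (λ s t → 1⟨ w ⟩ * ((1⟨ s ⟩ * (coefficient t x * Z)) * Y)) (++-assoc a c (d ++ e)) (++-assoc a c e) ⟨
        1⟨ w ⟩ * ((1⟨ (a ++ c) ++ d ++ e ⟩ * (coefficient ((a ++ c) ++ e) x * Z)) * Y)
          ≈⟨ K.*-congˡ (K.*-congʳ (coefficient-∘ j (a ++ c) d e ac≡j d≡p x z)) ⟨
        1⟨ w ⟩ * (coefficient ((a ++ c) ++ d ++ e) (compose x j z) * Y)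
          ≡⟨ cong (λ s → 1⟨ w ⟩ * (coefficient s (compose x j z) * Y)) (++-assoc a c (d ++ e)) ⟩
        1⟨ w ⟩ * (coefficient (a ++ c ++ d ++ e) (compose x j z) * Y)
          ≈⟨ coefficient-∘ l a b (c ++ d ++ e) a≡l b≡n (compose x j z) y ⟨
        coefficient w (compose (compose x j z) l y)  ∎
        where
        X = coefficient (a ++ c ++ e) x
        Y = coefficient b y
        Z = coefficient d z

        w≡ : ∀ v → (a ++ b ++ c) ++ v ≡ a ++ b ++ c ++ v
        w≡ v = trans (++-assoc a (b ++ c) v) (cong (a ++_) (++-assoc b c v))

  module _ {δ : RangeMap} (unimodal : Unimodal δ) where

    open RawOperad (cliffRawOperad δ)

    private
      length-++₂ : ∀ (a b : Word) {k l} → length a ≡ k → length b ≡ l → length (a ++ b) ≡ k ℕ.+ l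
      length-++₂ a b a≡ b≡ = trans (length-++ a) (cong₂ ℕ._+_ a≡ b≡)

      length-++₃ : ∀ (a b c : Word) {k l m} → length a ≡ k → length b ≡ l → length c ≡ m →
                   length (a ++ b ++ c) ≡ k ℕ.+ (l ℕ.+ m)
      length-++₃ a b c a≡ b≡ c≡ = length-++₂ a (b ++ c) a≡ (length-++₂ b c b≡ c≡)

      cast-≈ : ∀ {m n} (eq : m ≡ n) (x : Op m) (y : Op n) →
               (∀ (w : Cliff δ n) → coefficient (word w) x ≈ coefficient (word w) y) → subst Op eq x ≈ᴹ y
      cast-≈ refl x y p = p

    compose-sequential :
      ∀ {m n p} (x : Op m) (i : Fin m) (y : Op n) (j : Fin n) (z : Op p)
      (k : Fin (m ℕ.+ n ∸ 1)) → toℕ k ≡ toℕ i ℕ.+ toℕ j →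
      compose (compose x i y) k z ≋ compose x i (compose y j z)
    compose-sequential {suc m} {suc n} {p} x i y j z k k≡i+j = eq , cast-≈ eq (compose (compose x i y) k z) (compose x i (compose y j z)) (coordinates p z)
      where
      eq : suc m ℕ.+ suc n ∸ 1 ℕ.+ p ∸ 1 ≡ suc m ℕ.+ (suc n ℕ.+ p ∸ 1) ∸ 1
      eq = trans (cong (λ t → t ℕ.+ p ∸ 1) (ℕ.+-suc m n)) (ℕ.+-assoc m n p)

      coordinates : ∀ p (z : Op p) (w : Cliff δ (suc m ℕ.+ (suc n ℕ.+ p ∸ 1) ∸ 1)) →
                    coefficient (word w) (compose (compose x i y) k z) ≈
                    coefficient (word w) (compose x i (compose y j z))
      coordinates zero z w = begin
        coefficient (word w) (compose (compose x i y) k z)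
          ≡⟨ cong (coefficient (word w)) (trans (cong (compose (compose x i y) k) (arity-zero z)) (compose-zeroʳ (compose x i y) k)) ⟩
        0#
          ≡⟨ cong (coefficient (word w)) (trans (cong (compose x i) (trans (cong (compose y j) (arity-zero z)) (compose-zeroʳ y j))) (compose-zeroʳ x i)) ⟨
        coefficient (word w) (compose x i (compose y j z))  ∎
      coordinates (suc p) z w
        with m′ , m≡ ← ≤⇒∃+ (s≤s⁻¹ (toℕ<n i))
        with n′ , n≡ ← ≤⇒∃+ (s≤s⁻¹ (toℕ<n j))
        with a , b , c , d , e , w≡ , a≡ , b≡ , c≡ , d≡ ←
             split₅ {toℕ i} {toℕ j} {p} {n′} {m′} (word w) (ℕ.suc-injective (trans (size≡ w)
               (trans (cong₂ (λ s t → s ℕ.+ (t ℕ.+ suc p)) m≡ n≡)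
                 (ℕ-solve 5 (λ i m j n p → (i ⊕ m) ⊕ ((j ⊕ n) ⊕ (κ 1 ⊕ p)) ⊜ κ 1 ⊕ (i ⊕ (j ⊕ (p ⊕ (n ⊕ m)))))
                          refl (toℕ i) m′ (toℕ j) n′ p))))
        = subst (λ w → coefficient w (compose (compose x i y) k z) ≈ coefficient w (compose x i (compose y j z))) (sym w≡)
            (coefficient-sequential unimodal a b c d e (subst (IsCliff δ) w≡ (isCliff w)) x i y j z k a≡ b≡ c≡
              (trans (length-++₂ b d b≡ d≡) (sym n≡))
              (trans (length-++₂ a b a≡ b≡) (sym k≡i+j))
              (trans (length-++₃ b c d b≡ c≡ d≡)
                (trans (ℕ-solve 3 (λ j p n → j ⊕ (p ⊕ n) ⊜ (j ⊕ n) ⊕ p) refl (toℕ j) p n′)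
                  (trans (cong (ℕ._+ p) (sym n≡)) (cong (_∸ 1) (sym (ℕ.+-suc n p)))))))

    compose-parallel :
      ∀ {m n p} (x : Op m) (i j : Fin m) → i Fin.< j → (y : Op n) (z : Op p)
      (k : Fin (m ℕ.+ n ∸ 1)) → toℕ k ≡ toℕ j ℕ.+ n ∸ 1 →
      (l : Fin (m ℕ.+ p ∸ 1)) → toℕ l ≡ toℕ i →
      compose (compose x i y) k z ≋ compose (compose x j z) l y
    compose-parallel {suc m} {n} {p} x i j i<j y z k k≡ l l≡ =
      eq n p , cast-≈ (eq n p) (compose (compose x i y) k z) (compose (compose x j z) l y) (coordinates n p y z k k≡ l l≡)
      where
      eq : ∀ n p → suc m ℕ.+ n ∸ 1 ℕ.+ p ∸ 1 ≡ suc m ℕ.+ p ∸ 1 ℕ.+ n ∸ 1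
      eq n p = cong (_∸ 1) (ℕ-solve 3 (λ m n p → (m ⊕ n) ⊕ p ⊜ (m ⊕ p) ⊕ n) refl m n p)

      coordinates : ∀ n p (y : Op n) (z : Op p)
                    (k : Fin (suc m ℕ.+ n ∸ 1)) → toℕ k ≡ toℕ j ℕ.+ n ∸ 1 →
                    (l : Fin (suc m ℕ.+ p ∸ 1)) → toℕ l ≡ toℕ i →
                    (w : Cliff δ (suc m ℕ.+ p ∸ 1 ℕ.+ n ∸ 1)) →
                    coefficient (word w) (compose (compose x i y) k z) ≈
                    coefficient (word w) (compose (compose x j z) l y)
      coordinates zero p y z k k≡ l l≡ w = begin
        coefficient (word w) (compose (compose x i y) k z)
          ≡⟨ cong (λ t → coefficient (word w) (compose t k z)) (trans (cong (compose x i) (arity-zero y)) (compose-zeroʳ x i)) ⟩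
        0#
          ≡⟨ cong (coefficient (word w)) (trans (cong (compose (compose x j z) l) (arity-zero y)) (compose-zeroʳ (compose x j z) l)) ⟨
        coefficient (word w) (compose (compose x j z) l y)  ∎
      coordinates (suc n) zero y z k k≡ l l≡ w = begin
        coefficient (word w) (compose (compose x i y) k z)
          ≡⟨ cong (coefficient (word w)) (trans (cong (compose (compose x i y) k) (arity-zero z)) (compose-zeroʳ (compose x i y) k)) ⟩
        0#
          ≡⟨ cong (λ t → coefficient (word w) (compose t l y)) (trans (cong (compose x j) (arity-zero z)) (compose-zeroʳ x j)) ⟨
        coefficient (word w) (compose (compose x j z) l y)  ∎
      coordinates (suc n) (suc p) y z k k≡ l l≡ w
        with r , j≡ ← ≤⇒∃+ (ℕ.<⇒≤ i<j)
        with m′ , m≡ ← ≤⇒∃+ (s≤s⁻¹ (toℕ<n j))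
        with a , b , c , d , e , w≡ , a≡ , b≡ , c≡ , d≡ ←
             split₅ {toℕ i} {n} {r} {p} {m′} (word w) (ℕ.suc-injective (trans (size≡ w)
               (trans (cong (λ t → t ℕ.+ suc p ℕ.+ suc n ∸ 1) (trans m≡ (cong (ℕ._+ m′) j≡)))
                 (cong (_∸ 1) (ℕ-solve 5 (λ i n r p m → (((i ⊕ r) ⊕ m) ⊕ (κ 1 ⊕ p)) ⊕ (κ 1 ⊕ n) ⊜ κ 2 ⊕ (i ⊕ (n ⊕ (r ⊕ (p ⊕ m)))))
                          refl (toℕ i) n r p m′)))))
        = subst (λ w → coefficient w (compose (compose x i y) k z) ≈ coefficient w (compose (compose x j z) l y)) (sym w≡)
            (coefficient-parallel unimodal a b c d e (subst (IsCliff δ) w≡ (isCliff w)) x i j y z k l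
              a≡ (trans a≡ (sym l≡)) b≡ (trans (length-++₂ a c a≡ c≡) (sym j≡)) d≡
              (trans (length-++₃ a b c a≡ b≡ c≡)
                (trans (ℕ-solve 3 (λ i n r → i ⊕ (n ⊕ r) ⊜ (i ⊕ r) ⊕ n) refl (toℕ i) n r)
                  (trans (cong (ℕ._+ n) (sym j≡))
                    (sym (trans k≡ (cong (_∸ 1) (ℕ.+-suc (toℕ j) n))))))))

    compose-identityˡ : ∀ {n} (x : Op n) → compose 𝟏 zero x ≈ᴹ x
    compose-identityˡ {n} x w = begin
      coefficient v (compose 𝟏 zero x)
        ≡⟨ cong (λ v → coefficient v (compose 𝟏 zero x)) (++-identityʳ v) ⟨
      coefficient (v ++ []) (compose 𝟏 zero x)
        ≈⟨ coefficient-∘ zero [] v [] refl (cong (_∸ 1) (size≡ w)) 𝟏 x ⟩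
      𝟙 (isCliff? δ (v ++ [])) * ((1# * 1# + 0#) * coefficient v x)
        ≡⟨ cong (_* ((1# * 1# + 0#) * coefficient v x)) (𝟙-yes (isCliff? δ (v ++ [])) (subst (IsCliff δ) (sym (++-identityʳ v)) (isCliff w))) ⟩
      1# * ((1# * 1# + 0#) * coefficient v x)
        ≈⟨ solve 1 (λ X → con 1 :* ((con 1 :* con 1 :+ con 0) :* X) := X) K.refl (coefficient v x) ⟩
      coefficient v x  ∎
      where v = word w

    compose-identityʳ : ∀ {n} (x : Op n) (i : Fin n) → compose x i 𝟏 ≋ x
    compose-identityʳ {suc n} x i = eq , cast-≈ eq (compose x i 𝟏) x coordinates
      where
      eq : suc n ℕ.+ 1 ∸ 1 ≡ suc n
      eq = ℕ.+-comm n 1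

      coordinates : ∀ (w : Cliff δ (suc n)) → coefficient (word w) (compose x i 𝟏) ≈ coefficient (word w) x
      coordinates w
        with n′ , n≡ ← ≤⇒∃+ (s≤s⁻¹ (toℕ<n i))
        with a , c , w≡ , a≡ , _ ← split {toℕ i} {n′} (word w) (trans (ℕ.suc-injective (size≡ w)) n≡)
        = subst (λ w → coefficient w (compose x i 𝟏) ≈ coefficient w x) (sym w≡) (begin
            coefficient (a ++ c) (compose x i 𝟏)
              ≈⟨ coefficient-∘ i a [] c a≡ refl x 𝟏 ⟩
            𝟙 (isCliff? δ (a ++ c)) * (coefficient (a ++ c) x * (1# * 1# + 0#))
              ≡⟨ cong (_* (coefficient (a ++ c) x * (1# * 1# + 0#))) (𝟙-yes (isCliff? δ (a ++ c)) (subst (IsCliff δ) w≡ (isCliff w))) ⟩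
            1# * (coefficient (a ++ c) x * (1# * 1# + 0#))
              ≈⟨ solve 1 (λ X → con 1 :* (X :* (con 1 :* con 1 :+ con 0)) := X) K.refl (coefficient (a ++ c) x) ⟩
            coefficient (a ++ c) x  ∎)

  compose-coordinates : ∀ {δ m n} (i : Fin m) (w : Cliff δ (m ℕ.+ n ∸ 1)) →
    ∃[ r ] ∃[ u ] ∃[ v ] ∀ (x : List (Carrier × Cliff δ m)) (y : List (Carrier × Cliff δ n)) →
    coefficient (word w) (compose x i y) ≈ r * (coefficient u x * coefficient v y)
  compose-coordinates {δ} {suc m} {zero} i w = 0# , [] , [] , λ x y → K.trans
    (K.reflexive (cong (coefficient (word w)) (trans (cong (compose x i) (arity-zero y)) (compose-zeroʳ x i))))
    (K.sym (K.zeroˡ _))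
  compose-coordinates {δ} {suc m} {suc n} i w
    with m′ , m≡ ← ≤⇒∃+ (s≤s⁻¹ (toℕ<n i))
    with a , w₁ , w≡ , a≡ , w₁≡ ← split {toℕ i} {n ℕ.+ m′} (word w) (ℕ.suc-injective (trans (size≡ w)
      (trans (cong (ℕ._+ suc n) m≡)
        (ℕ-solve 3 (λ i m n → (i ⊕ m) ⊕ (κ 1 ⊕ n) ⊜ κ 1 ⊕ (i ⊕ (n ⊕ m))) refl (toℕ i) m′ n))))
    with b , c , refl , b≡ , _ ← split {n} {m′} w₁ w₁≡
    = 𝟙 (isCliff? δ (a ++ b ++ c)) , a ++ c , b , λ x y →
      K.trans (K.reflexive (cong (λ w → coefficient w (compose x i y)) w≡)) (coefficient-∘ i a b c a≡ b≡ x y)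

  cliffIsOperad : ∀ {δ} → Unimodal δ → IsOperad (cliffRawOperad δ)
  cliffIsOperad {δ} unimodal = record
    { isLeftModule = freeModule-isLeftModule δ
    ; ∘-cong = λ {m} {n} {x} {x′} {y} {y′} i x≈x′ y≈y′ w →
        let r , u , v , eq = compose-coordinates i w in
        K.trans (eq x y) (K.trans (K.*-congˡ (K.*-cong (coefficient-cong u {x} {x′} x≈x′) (coefficient-cong v {y} {y′} y≈y′))) (K.sym (eq x′ y′)))
    ; ∘-distribʳ = λ x x′ i y w → let r , u , v , eq = compose-coordinates i w in begin
        coefficient (word w) (compose (x ++ x′) i y)
          ≈⟨ eq (x ++ x′) y ⟩
        r * (coefficient u (x ++ x′) * coefficient v y)
          ≈⟨ K.*-congˡ (K.*-congʳ (coefficient-++ u x x′)) ⟩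
        r * ((coefficient u x + coefficient u x′) * coefficient v y)
          ≈⟨ solve 4 (λ r X X′ Y → r :* ((X :+ X′) :* Y) := r :* (X :* Y) :+ r :* (X′ :* Y)) K.refl r _ _ _ ⟩
        r * (coefficient u x * coefficient v y) + r * (coefficient u x′ * coefficient v y)
          ≈⟨ K.+-cong (eq x y) (eq x′ y) ⟨
        coefficient (word w) (compose x i y) + coefficient (word w) (compose x′ i y)
          ≈⟨ coefficient-++ (word w) (compose x i y) (compose x′ i y) ⟨
        coefficient (word w) (compose x i y ++ compose x′ i y)  ∎
    ; ∘-distribˡ = λ x i y y′ w → let r , u , v , eq = compose-coordinates i w in begin
        coefficient (word w) (compose x i (y ++ y′))
          ≈⟨ eq x (y ++ y′) ⟩
        r * (coefficient u x * coefficient v (y ++ y′))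
          ≈⟨ K.*-congˡ (K.*-congˡ (coefficient-++ v y y′)) ⟩
        r * (coefficient u x * (coefficient v y + coefficient v y′))
          ≈⟨ solve 4 (λ r X Y Y′ → r :* (X :* (Y :+ Y′)) := r :* (X :* Y) :+ r :* (X :* Y′)) K.refl r _ _ _ ⟩
        r * (coefficient u x * coefficient v y) + r * (coefficient u x * coefficient v y′)
          ≈⟨ K.+-cong (eq x y) (eq x y′) ⟨
        coefficient (word w) (compose x i y) + coefficient (word w) (compose x i y′)
          ≈⟨ coefficient-++ (word w) (compose x i y) (compose x i y′) ⟨
        coefficient (word w) (compose x i y ++ compose x i y′)  ∎
    ; ∘-*ₗˡ = λ s x i y w → let r , u , v , eq = compose-coordinates i w in begin
        coefficient (word w) (compose (scale s x) i y)
          ≈⟨ eq (scale s x) y ⟩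
        r * (coefficient u (scale s x) * coefficient v y)
          ≈⟨ K.*-congˡ (K.*-congʳ (coefficient-scale u s x)) ⟩
        r * ((s * coefficient u x) * coefficient v y)
          ≈⟨ solve 4 (λ r s X Y → r :* ((s :* X) :* Y) := s :* (r :* (X :* Y))) K.refl r s _ _ ⟩
        s * (r * (coefficient u x * coefficient v y))
          ≈⟨ K.*-congˡ (eq x y) ⟨
        s * coefficient (word w) (compose x i y)
          ≈⟨ coefficient-scale (word w) s (compose x i y) ⟨
        coefficient (word w) (scale s (compose x i y))  ∎
    ; ∘-*ₗʳ = λ s x i y w → let r , u , v , eq = compose-coordinates i w in begin
        coefficient (word w) (compose x i (scale s y))
          ≈⟨ eq x (scale s y) ⟩
        r * (coefficient u x * coefficient v (scale s y))
          ≈⟨ K.*-congˡ (K.*-congˡ (coefficient-scale v s y)) ⟩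
        r * (coefficient u x * (s * coefficient v y))
          ≈⟨ solve 4 (λ r s X Y → r :* (X :* (s :* Y)) := s :* (r :* (X :* Y))) K.refl r s _ _ ⟩
        s * (r * (coefficient u x * coefficient v y))
          ≈⟨ K.*-congˡ (eq x y) ⟨
        s * coefficient (word w) (compose x i y)
          ≈⟨ coefficient-scale (word w) s (compose x i y) ⟨
        coefficient (word w) (scale s (compose x i y))  ∎
    ; ∘-sequential = compose-sequential unimodal
    ; ∘-parallel   = compose-parallel unimodal
    ; ∘-identityˡ  = λ {n} → compose-identityˡ unimodal {n}
    ; ∘-identityʳ  = compose-identityʳ unimodal
    }

  cliffOperad : ∀ {δ} → Unimodal δ → Operad K c ℓ
  cliffOperad unimodal = record { isOperad = cliffIsOperad unimodal }

  ∑ : ∀ {A : Set} → List A → (A → Carrier) → Carrier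
  ∑ []       f = 0#
  ∑ (x ∷ xs) f = f x + ∑ xs f

  -- The Möbius function of ≼ on the cliffs of a given size, with values in K:
  -- μ w w = 1, and otherwise μ w w′ is minus the sum of μ w z over w ≼ z ≺ w′,
  -- which is empty unless w ≼ w′.
  μ : ∀ {δ n} → Cliff δ n → Cliff δ n → Carrier
  μ {δ} {n} w w′ = go w′ (<-wellFounded _)
    where
    go : (w′ : Cliff δ n) → Acc _<_ (sum (word w′)) → Carrier
    go w′ (acc rec) with word w ≟ word w′
    ... | yes _ = 1#
    ... | no  _ = - ∑ (cliffs δ n) λ z → case (w ≼? z) ×-dec (z ≺? w′) of λ where
      (yes (_ , z≺w′)) → go z (rec (≺⇒sum< {u = z} {v = w′} z≺w′))
      (no  _)          → 0#

  F : ∀ {δ n} → Cliff δ n → List (Carrier × Cliff δ n)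
  F {δ} {n} w = map (λ w′ → μ w w′ , w′) (filter (w ≼?_) (cliffs δ n))

GradedSubset : RangeMap → (p : Level) → Set (lsuc p)
GradedSubset δ p = ∀ n → Pred (Cliff δ n) p

Nonempty : ∀ {δ} → GradedSubset δ p → Set p
Nonempty S = ∃[ n ] ∃[ w ] S n w

ClosedBySubwordReduction : ∀ {δ} → GradedSubset δ p → Set p
ClosedBySubwordReduction {δ = δ} S =
  ∀ {n} (w : Cliff δ n) → S n w → ∀ w′ → w′ ⊆ word w → S (suc (length w′)) (reduction δ w′)

𝒱 : (K : CommutativeRing c ℓ) → ∀ {δ} → GradedSubset δ p → ∀ n → Pred (RawOperad.Op (cliffRawOperad K δ) n) (c ⊔ ℓ ⊔ p)
𝒱 K {δ} S n = Span (freeModule K δ n) λ x → ∃[ w ] ¬ S n w × x ≡ F K w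

{-# OPTIONS --safe #-}

-- Let φ_t x be the coefficient of F_t in x, that is, the sum of the coefficients
-- of the E_w in x over w ≼ t; this makes sense for every word t, and φ_t is φ of
-- the δ-reduction of t.  If t = a b c is a cliff, b being the block filled by y, the
-- words below t are the a′ b′ c′ with a′ c′ below a c and b′ below b, and they are
-- all cliffs, so φ_t (x ∘ᵢ y) = φ_{ac} x · φ_b y.  Hence F_w ∘ᵢ y is a combination
-- of those F_t for which a c reduces to w, and for w ∉ S closure of S under subword
-- reduction gives t ∉ S; likewise for x ∘ᵢ F_w with b in place of a c.

module Submission where

open import Algebra.Bundles using (AbelianGroup; CommutativeRing; Ring)
open import Algebra.Module.Bundles using (LeftModule)
open import Algebra.Module.Bundles.Raw using (RawLeftModule)
open import Algebra.Module.Structures using (IsLeftModule)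
import Algebra.Properties.AbelianGroup as AbelianGroupProperties
import Algebra.Properties.CommutativeSemigroup as CommutativeSemigroupProperties
import Algebra.Properties.Ring as RingProperties
import Algebra.Solver.Ring.NaturalCoefficients.Default as SemiringSolver
open import Data.Fin.Base using (Fin; zero; suc; toℕ)
open import Data.Fin.Properties using (toℕ<n)
open import Data.List.Base
  using (List; []; _∷_; _++_; map; concatMap; length; lookup; take; drop; tabulate; filter)
open import Data.List.Membership.Propositional using (_∈_)
open import Data.List.Membership.Propositional.Properties
  using (∈-cartesianProductWith⁺; ∈-upTo⁺; ∈-map⁻; map-mapWith∈; mapWith∈-id)
open import Data.List.Properties using (∷-injective; take++drop≡id)
open import Data.List.Relation.Binary.Pointwise as Pointwise using (Pointwise; []; _∷_)
open import Data.List.Relation.Binary.Sublist.Propositional using (_⊆_; ⊆-refl; ⊆-trans)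
open import Data.List.Relation.Binary.Sublist.Propositional.Properties using (take-⊆; drop-⊆; ++⁺)
open import Data.List.Relation.Unary.All as All using (All; []; _∷_)
import Data.List.Relation.Unary.All.Properties as All
open import Data.List.Relation.Unary.AllPairs using ([]; _∷_)
open import Data.List.Relation.Unary.Any using (here; there)
open import Data.List.Relation.Unary.Unique.Propositional using (Unique)
import Data.List.Relation.Unary.Unique.Propositional.Properties as Unique
open import Data.Nat.Base as ℕ using (ℕ; zero; suc; _∸_; _⊓_; _≤_; _<_; z≤n; s≤s; s≤s⁻¹)
open import Data.Nat.Induction using (<-wellFounded; <′-wellFounded; <′-wellFounded′)
open import Data.Nat.ListAction using (sum)
import Data.Nat.Properties as ℕ
open import Data.Product.Base using (∃-syntax; _×_; _,_; proj₁; proj₂; map₁)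
open import Function.Base using (id; _∘_)
open import Induction.WellFounded using (Acc; acc)
open import Level using (Level)
open import Relation.Binary.PropositionalEquality
  using (_≡_; _≢_; refl; sym; trans; cong; cong₂; subst)
open import Relation.Nullary using (¬_; Dec; yes; no; ¬?; _×-dec_; contradiction)
open import Relation.Unary using (Pred)
open import Defs

private
  variable
    c ℓ p q a ℓa b ℓb : Level
    δ : RangeMap
    n : ℕ

-- Quotient modules, spans and their images under linear maps

module _ {R : Ring c ℓ} (M : LeftModule R a ℓa) where
  open Ring R using (Carrier; 0#; 1#; _*_) renaming (_+_ to _+ᴿ_; -_ to -ᴿ_; -‿inverseʳ to -ᴿ‿inverseʳ)
  open LeftModule M
  open AbelianGroupProperties +ᴹ-abelianGroup
    using (inverseʳ-unique; ⁻¹-∙-comm; ⁻¹-anti-homo-//; \\-leftDividesʳ; x≈y⇒x∙y⁻¹≈ε)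
  open CommutativeSemigroupProperties (AbelianGroup.commutativeSemigroup +ᴹ-abelianGroup)
    using (interchange)
  open import Relation.Binary.Reasoning.Setoid ≈ᴹ-setoid

  -1*ₗ≈-ᴹ : ∀ x → (-ᴿ 1#) *ₗ x ≈ᴹ -ᴹ x
  -1*ₗ≈-ᴹ x = inverseʳ-unique x _ (begin
    x +ᴹ (-ᴿ 1#) *ₗ x           ≈⟨ +ᴹ-congʳ (*ₗ-identityˡ x) ⟨
    1# *ₗ x +ᴹ (-ᴿ 1#) *ₗ x     ≈⟨ *ₗ-distribʳ x 1# (-ᴿ 1#) ⟨
    (1# +ᴿ -ᴿ 1#) *ₗ x          ≈⟨ *ₗ-congʳ (-ᴿ‿inverseʳ 1#) ⟩
    0# *ₗ x                     ≈⟨ *ₗ-zeroˡ x ⟩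
    0ᴹ                          ∎)

  *ₗ-distrib-minus : ∀ a x y → a *ₗ x +ᴹ -ᴹ (a *ₗ y) ≈ᴹ a *ₗ (x +ᴹ -ᴹ y)
  *ₗ-distrib-minus a x y = begin
    a *ₗ x +ᴹ -ᴹ (a *ₗ y)  ≈⟨ +ᴹ-congˡ (inverseʳ-unique (a *ₗ y) (a *ₗ -ᴹ y) (begin
      a *ₗ y +ᴹ a *ₗ -ᴹ y    ≈⟨ *ₗ-distribˡ a y (-ᴹ y) ⟨
      a *ₗ (y +ᴹ -ᴹ y)       ≈⟨ *ₗ-congˡ (-ᴹ‿inverseʳ y) ⟩
      a *ₗ 0ᴹ                ≈⟨ *ₗ-zeroʳ a ⟩
      0ᴹ                     ∎)) ⟨
    a *ₗ x +ᴹ a *ₗ -ᴹ y    ≈⟨ *ₗ-distribˡ a x (-ᴹ y) ⟨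
    a *ₗ (x +ᴹ -ᴹ y)       ∎

  telescope : ∀ x y z → (x +ᴹ -ᴹ y) +ᴹ (y +ᴹ -ᴹ z) ≈ᴹ x +ᴹ -ᴹ z
  telescope x y z = begin
    (x +ᴹ -ᴹ y) +ᴹ (y +ᴹ -ᴹ z)  ≈⟨ +ᴹ-assoc x (-ᴹ y) _ ⟩
    x +ᴹ (-ᴹ y +ᴹ (y +ᴹ -ᴹ z))  ≈⟨ +ᴹ-congˡ (\\-leftDividesʳ y (-ᴹ z)) ⟩
    x +ᴹ -ᴹ z                   ∎

  module _ {V : Pred Carrierᴹ p} (V-isSubmodule : IsSubmodule rawLeftModule V) where
    open IsSubmodule V-isSubmodule

    private
      infix 4 _∼_
      _∼_ : Carrierᴹ → Carrierᴹ → Set p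
      x ∼ y = V (x +ᴹ -ᴹ y)

    -ᴹ-closed : ∀ {x} → V x → V (-ᴹ x)
    -ᴹ-closed {x} Vx = respects (-1*ₗ≈-ᴹ x) (*ₗ-closed (-ᴿ 1#) Vx)

    ≈⇒difference : ∀ {x y} → x ≈ᴹ y → x ∼ y
    ≈⇒difference x≈y = respects (≈ᴹ-sym (x≈y⇒x∙y⁻¹≈ε x≈y)) 0-closed

    difference-trans : ∀ {x y z} → x ∼ y → y ∼ z → x ∼ z
    difference-trans {x} {y} {z} x∼y y∼z = respects (telescope x y z) (+-closed x∼y y∼z)

    quotient-isLeftModule : IsLeftModule R _∼_ _+ᴹ_ 0ᴹ -ᴹ_ _*ₗ_
    quotient-isLeftModule = record
      { isLeftSemimodule = record
        { +ᴹ-isCommutativeMonoid = record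
          { isMonoid = record
            { isSemigroup = record
              { isMagma = record
                { isEquivalence = record
                  { refl  = ≈⇒difference ≈ᴹ-refl
                  ; sym   = λ {x} {y} x∼y → respects (⁻¹-anti-homo-// x y) (-ᴹ-closed x∼y)
                  ; trans = difference-trans
                  }
                ; ∙-cong = λ {x} {y} {u} {v} x∼y u∼v → respects
                    (≈ᴹ-trans (interchange x (-ᴹ y) u (-ᴹ v)) (+ᴹ-congˡ (⁻¹-∙-comm y v))) (+-closed x∼y u∼v)
                }
              ; assoc = λ x y z → ≈⇒difference (+ᴹ-assoc x y z)
              }
            ; identity = (λ x → ≈⇒difference (+ᴹ-identityˡ x)) , (λ x → ≈⇒difference (+ᴹ-identityʳ x))
            }
          ; comm = λ x y → ≈⇒difference (+ᴹ-comm x y)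
          }
        ; isPreleftSemimodule = record
          { *ₗ-cong      = λ {a} {b} {x} {y} a≈b x∼y → difference-trans
              (respects (≈ᴹ-sym (*ₗ-distrib-minus a x y)) (*ₗ-closed a x∼y))
              (≈⇒difference (*ₗ-congʳ a≈b))
          ; *ₗ-zeroˡ     = λ x → ≈⇒difference (*ₗ-zeroˡ x)
          ; *ₗ-distribʳ  = λ x a b → ≈⇒difference (*ₗ-distribʳ x a b)
          ; *ₗ-identityˡ = λ x → ≈⇒difference (*ₗ-identityˡ x)
          ; *ₗ-assoc     = λ a b x → ≈⇒difference (*ₗ-assoc a b x)
          ; *ₗ-zeroʳ     = λ a → ≈⇒difference (*ₗ-zeroʳ a)
          ; *ₗ-distribˡ  = λ a x y → ≈⇒difference (*ₗ-distribˡ a x y)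
          }
        }
      ; -ᴹ‿cong    = λ {x} {y} x∼y → respects (≈ᴹ-sym (⁻¹-∙-comm x (-ᴹ y))) (-ᴹ-closed x∼y)
      ; -ᴹ‿inverse = (λ x → ≈⇒difference (-ᴹ‿inverseˡ x)) , (λ x → ≈⇒difference (-ᴹ‿inverseʳ x))
      }

  linearCombination-++ : ∀ xs ys → linearCombination rawLeftModule (xs ++ ys) ≈ᴹ
                         linearCombination rawLeftModule xs +ᴹ linearCombination rawLeftModule ys
  linearCombination-++ []             ys = ≈ᴹ-sym (+ᴹ-identityˡ _)
  linearCombination-++ ((a , x) ∷ xs) ys =
    ≈ᴹ-trans (+ᴹ-congˡ (linearCombination-++ xs ys)) (≈ᴹ-sym (+ᴹ-assoc _ _ _))

  linearCombination-scale : ∀ a xs → linearCombination rawLeftModule (map (map₁ (a *_)) xs) ≈ᴹ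
                            a *ₗ linearCombination rawLeftModule xs
  linearCombination-scale a []             = ≈ᴹ-sym (*ₗ-zeroʳ a)
  linearCombination-scale a ((b , x) ∷ xs) =
    ≈ᴹ-trans (+ᴹ-cong (*ₗ-assoc a b x) (linearCombination-scale a xs)) (≈ᴹ-sym (*ₗ-distribˡ a _ _))

  span-isSubmodule : (G : Pred Carrierᴹ p) → IsSubmodule rawLeftModule (Span rawLeftModule G)
  span-isSubmodule G = record
    { respects  = λ x≈y (xs , Gxs , x≈) → xs , Gxs , ≈ᴹ-trans (≈ᴹ-sym x≈y) x≈
    ; 0-closed  = [] , [] , ≈ᴹ-refl
    ; +-closed  = λ (xs , Gxs , x≈) (ys , Gys , y≈) →
        xs ++ ys , All.++⁺ Gxs Gys , ≈ᴹ-trans (+ᴹ-cong x≈ y≈) (≈ᴹ-sym (linearCombination-++ xs ys))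
    ; *ₗ-closed = λ a (xs , Gxs , x≈) →
        map (map₁ (a *_)) xs , All.map⁺ Gxs , ≈ᴹ-trans (*ₗ-congˡ x≈) (≈ᴹ-sym (linearCombination-scale a xs))
    }

module _ {R : Ring c ℓ} (M : LeftModule R a ℓa) (N : LeftModule R b ℓb) where
  private
    module M = LeftModule M
    module N = LeftModule N
  open Ring R using (0#)

  -- Serves to reduce the two ideal conditions to the generators `F K w`, composition being linear
  -- in each argument.
  span-image : {G : Pred M.Carrierᴹ p} {V : Pred N.Carrierᴹ q} (f : M.Carrierᴹ → N.Carrierᴹ) →
    (∀ {x y} → x M.≈ᴹ y → f x N.≈ᴹ f y) → (∀ x y → f (x M.+ᴹ y) N.≈ᴹ f x N.+ᴹ f y) →
    (∀ a x → f (a M.*ₗ x) N.≈ᴹ a N.*ₗ f x) →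
    IsSubmodule N.rawLeftModule V → (∀ {x} → G x → V (f x)) →
    ∀ {x} → Span M.rawLeftModule G x → V (f x)
  span-image {G = G} {V} f f-cong f-+ f-*ₗ V-isSubmodule Vf (xs , Gxs , x≈) =
    respects (N.≈ᴹ-sym (f-cong x≈)) (image xs Gxs)
    where
    open IsSubmodule V-isSubmodule
    image : ∀ xs → All (G ∘ proj₂) xs → V (f (linearCombination M.rawLeftModule xs))
    -- `f` preserves zero because zero is `0#` times a vector and `f` commutes with scalars.
    image []             []         = respects
      (N.≈ᴹ-sym (N.≈ᴹ-trans (f-cong (M.≈ᴹ-sym (M.*ₗ-zeroˡ M.0ᴹ))) (N.≈ᴹ-trans (f-*ₗ 0# M.0ᴹ) (N.*ₗ-zeroˡ _))))
      0-closed
    image ((a , x) ∷ xs) (Gx ∷ Gxs) = respects (N.≈ᴹ-sym (f-+ _ _))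
      (+-closed (respects (N.≈ᴹ-sym (f-*ₗ a x)) (*ₗ-closed a (Vf Gx))) (image xs Gxs))

-- Quotient of an operad by an ideal

module _ {K : CommutativeRing c ℓ} (O : Operad K a ℓa) {V : ∀ n → Pred (Operad.Op O n) p}
         (V-isIdeal : IsOperadIdeal O V) where
  open Operad O
  open IsOperadIdeal V-isIdeal
  private
    module Q = RawOperad (O / V)

    leftModule : ℕ → LeftModule (CommutativeRing.ring K) a ℓa
    leftModule n = record { isLeftModule = isLeftModule n }

    module M {n} = LeftModule (leftModule n)
    module V {n} = IsSubmodule (isSubmodule n)

    ≈⇒Q≈ : ∀ {n} {x y : Op n} → x ≈ᴹ y → x Q.≈ᴹ y
    ≈⇒Q≈ {n} = ≈⇒difference (leftModule n) (isSubmodule n)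

    ≋⇒Q≋ : ∀ {m n} {x : Op m} {y : Op n} → x ≋ y → x Q.≋ y
    ≋⇒Q≋ (eq , x≈y) = eq , ≈⇒Q≈ x≈y

    -- The difference of `f x` and `f y` is `f` of the difference; `-ᴹ y` is written as a scalar
    -- multiple of `y` so that linearity applies to it.
    linear⇒cong : ∀ {m n} (f : Op m → Op n) →
      (∀ x y → f (x +ᴹ y) ≈ᴹ f x +ᴹ f y) → (∀ a x → f (a *ₗ x) ≈ᴹ a *ₗ f x) →
      (∀ {x y} → x ≈ᴹ y → f x ≈ᴹ f y) → (∀ {x} → V m x → V n (f x)) →
      ∀ {x y} → x Q.≈ᴹ y → f x Q.≈ᴹ f y
    linear⇒cong f f-+ f-*ₗ f-cong f-closed {x} {y} x∼y = V.respects
      (M.≈ᴹ-trans (f-+ x (-ᴹ y)) (M.+ᴹ-congˡ (M.≈ᴹ-trans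
        (f-cong (M.≈ᴹ-sym (-1*ₗ≈-ᴹ (leftModule _) y))) (M.≈ᴹ-trans (f-*ₗ _ y) (-1*ₗ≈-ᴹ (leftModule _) (f y))))))
      (f-closed x∼y)

  -- Identities of `O` persist because equal elements have their difference in `V`; closure of `V`
  -- under composition enters only through `∘-cong`.
  quotient-isOperad : IsOperad (O / V)
  quotient-isOperad = record
    { isLeftModule = λ n → quotient-isLeftModule (leftModule n) (isSubmodule n)
    -- One argument changes at a time, through `x′ ∘⟨ i ⟩ y`.
    ; ∘-cong       = λ {_} {_} {x} {x′} {y} {y′} i x∼x′ y∼y′ → difference-trans (leftModule _) (isSubmodule _)
        (linear⇒cong (_∘⟨ i ⟩ y) (λ x x′ → ∘-distribʳ x x′ i y) (λ a x → ∘-*ₗˡ a x i y)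
          (λ x≈x′ → ∘-cong i x≈x′ M.≈ᴹ-refl) (∘-closedˡ i y) x∼x′)
        (linear⇒cong (x′ ∘⟨ i ⟩_) (∘-distribˡ x′ i) (λ a y → ∘-*ₗʳ a x′ i y)
          (λ y≈y′ → ∘-cong i M.≈ᴹ-refl y≈y′) (∘-closedʳ x′ i) y∼y′)
    ; ∘-distribʳ   = λ x x′ i y → ≈⇒Q≈ (∘-distribʳ x x′ i y)
    ; ∘-distribˡ   = λ x i y y′ → ≈⇒Q≈ (∘-distribˡ x i y y′)
    ; ∘-*ₗˡ        = λ a x i y → ≈⇒Q≈ (∘-*ₗˡ a x i y)
    ; ∘-*ₗʳ        = λ a x i y → ≈⇒Q≈ (∘-*ₗʳ a x i y)
    ; ∘-sequential = λ x i y j z k k≡ → ≋⇒Q≋ (∘-sequential x i y j z k k≡)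
    ; ∘-parallel   = λ x i j i<j y z k k≡ l l≡ → ≋⇒Q≋ (∘-parallel x i j i<j y z k k≡ l l≡)
    ; ∘-identityˡ  = λ x → ≈⇒Q≈ (∘-identityˡ x)
    ; ∘-identityʳ  = λ x i → ≋⇒Q≋ (∘-identityʳ x i)
    }

  projection-isOperadEpimorphism : IsOperadEpimorphism rawOperad (O / V) (λ n → id)
  projection-isOperadEpimorphism = record
    { isLeftModuleHomomorphism = λ n → record
      { +ᴹ-isGroupHomomorphism = record
        { isMonoidHomomorphism = record
          { isMagmaHomomorphism = record
            { isRelHomomorphism = record { cong = ≈⇒Q≈ }
            ; homo = λ x y → ≈⇒Q≈ M.≈ᴹ-refl
            }
          ; ε-homo = ≈⇒Q≈ M.≈ᴹ-refl
          }
        ; ⁻¹-homo = λ x → ≈⇒Q≈ M.≈ᴹ-refl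
        }
      ; *ₗ-homo = λ a x → ≈⇒Q≈ M.≈ᴹ-refl
      }
    ; ∘-homo     = λ x i y → ≈⇒Q≈ M.≈ᴹ-refl
    ; 𝟏-homo     = ≈⇒Q≈ M.≈ᴹ-refl
    ; surjective = λ n y → y , ≈⇒Q≈
    }

-- Insertion and truncation of words under letterwise comparison

-- inside i k (u □⟨ i ⟩ v) is v and outside i k (u □⟨ i ⟩ v) is u when v has
-- length k and i ≤ length u.
inside outside : ℕ → ℕ → Word → Word
inside  i k t = take k (drop i t)
outside i k t = take i t ++ drop k (drop i t)

inside-⊆ : ∀ i k t → inside i k t ⊆ t
inside-⊆ i k t = ⊆-trans (take-⊆ k (drop i t)) (drop-⊆ i t)

outside-⊆ : ∀ i k t → outside i k t ⊆ t
outside-⊆ i k t = subst (outside i k t ⊆_) (take++drop≡id i t) (++⁺ (⊆-refl {x = take i t}) (drop-⊆ k (drop i t)))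

-- Letterwise comparison can be read separately on the positions filled by `v` and on the others.
-- With the converse `□-⊑⁺`, this is what makes `F-coefficient` multiplicative.
□-⊑⁻ : ∀ i u v t → i ≤ length u → Pointwise _≤_ (u □⟨ i ⟩ v) t →
       Pointwise _≤_ u (outside i (length v) t) × Pointwise _≤_ v (inside i (length v) t)
□-⊑⁻ zero    u       []      t       _   uv⊑t         = uv⊑t , []
□-⊑⁻ zero    u       (b ∷ v) (c ∷ t) _   (b≤c ∷ uv⊑t) =
  let u⊑ , v⊑ = □-⊑⁻ zero u v t z≤n uv⊑t in u⊑ , b≤c ∷ v⊑
□-⊑⁻ (suc i) (a ∷ u) v       (c ∷ t) i≤u (a≤c ∷ uv⊑t) =
  let u⊑ , v⊑ = □-⊑⁻ i u v t (s≤s⁻¹ i≤u) uv⊑t in a≤c ∷ u⊑ , v⊑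

□-⊑⁺ : ∀ i u v t → i ≤ length u →
       Pointwise _≤_ u (outside i (length v) t) → Pointwise _≤_ v (inside i (length v) t) →
       Pointwise _≤_ (u □⟨ i ⟩ v) t
□-⊑⁺ zero    u       []      t       _   u⊑         _          = u⊑
□-⊑⁺ zero    u       (b ∷ v) (c ∷ t) _   u⊑         (b≤c ∷ v⊑) = b≤c ∷ □-⊑⁺ zero u v t z≤n u⊑ v⊑
-- Here `t` is too short: its outside part is empty and cannot dominate `a ∷ u`. Splitting the
-- inserted word lets `drop` compute on the empty word.
□-⊑⁺ (suc i) (a ∷ u) []      []      _   ()         _
□-⊑⁺ (suc i) (a ∷ u) (_ ∷ _) []      _   ()         _
□-⊑⁺ (suc i) (a ∷ u) v       (c ∷ t) i≤u (a≤c ∷ u⊑) v⊑         = a≤c ∷ □-⊑⁺ i u v t (s≤s⁻¹ i≤u) u⊑ v⊑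

-- Used in contrapositive form: an insertion that is not a cliff, and so gives a zero composite,
-- lies below no cliff.
⊑-bounded : ∀ {u t} (g : ℕ → ℕ) → Pointwise _≤_ u t → (∀ i → lookup t i ≤ g (toℕ i)) → ∀ i → lookup u i ≤ g (toℕ i)
⊑-bounded g (a≤b ∷ _)   bnd zero    = ℕ.≤-trans a≤b (bnd zero)
⊑-bounded g (_   ∷ u⊑t) bnd (suc i) = ⊑-bounded (g ∘ suc) u⊑t (bnd ∘ suc) i

-- For `g i = δ (suc i)` the tabulated word is `reduction δ t`; a general `g` lets the induction
-- shift the bounds.
⊑-truncation⁺ : ∀ (g : ℕ → ℕ) {v} → (∀ i → lookup v i ≤ g (toℕ i)) → ∀ {t} → Pointwise _≤_ v t →
                Pointwise _≤_ v (tabulate λ i → lookup t i ⊓ g (toℕ i))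
⊑-truncation⁺ g bnd []          = []
⊑-truncation⁺ g bnd (a≤b ∷ v⊑t) = ℕ.⊓-glb a≤b (bnd zero) ∷ ⊑-truncation⁺ (g ∘ suc) (bnd ∘ suc) v⊑t

⊑-truncation⁻ : ∀ (g : ℕ → ℕ) {v} t → Pointwise _≤_ v (tabulate λ i → lookup t i ⊓ g (toℕ i)) → Pointwise _≤_ v t
⊑-truncation⁻ g []      []         = []
⊑-truncation⁻ g (b ∷ t) (a≤ ∷ v⊑t) = ℕ.m≤n⊓o⇒m≤n b (g 0) a≤ ∷ ⊑-truncation⁻ (g ∘ suc) t v⊑t

-- Enumeration of the cliffs, and the letterwise order

word-injective : {u v : Cliff δ n} → word u ≡ word v → u ≡ v
-- The other two fields are irrelevant.
word-injective {u = cliff _ _ _} {v = cliff _ _ _} refl = refl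

boundedWords-unique : ∀ g n → Unique (boundedWords g n)
boundedWords-unique g zero    = [] ∷ []
boundedWords-unique g (suc n) =
  Unique.cartesianProductWith⁺ _∷_ ∷-injective (Unique.upTo⁺ (suc (g 0))) (boundedWords-unique (g ∘ suc) n)

boundedWords-complete : ∀ g w → (∀ i → lookup w i ≤ g (toℕ i)) → w ∈ boundedWords g (length w)
boundedWords-complete g []      _   = here refl
boundedWords-complete g (a ∷ w) bnd =
  ∈-cartesianProductWith⁺ _∷_ (∈-upTo⁺ (s≤s (bnd zero))) (boundedWords-complete (g ∘ suc) w (bnd ∘ suc))

-- Dropping the proofs attached by `cliffs` recovers the bounded words, so uniqueness and
-- completeness carry over from there.
map-word-cliffs : ∀ δ n → map word (cliffs δ (suc n)) ≡ boundedWords (λ i → δ (suc i)) n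
map-word-cliffs δ n = trans (map-mapWith∈ (boundedWords (λ i → δ (suc i)) n) _ word) (mapWith∈-id _)

cliffs-unique : ∀ δ n → Unique (cliffs δ n)
cliffs-unique δ zero    = []
cliffs-unique δ (suc n) =
  Unique.map⁻ (subst Unique (sym (map-word-cliffs δ n)) (boundedWords-unique (λ i → δ (suc i)) n))

infix 4 _⊑?_
_⊑?_ : (u v : Word) → Dec (Pointwise _≤_ u v)
_⊑?_ = Pointwise.decidable ℕ._≤?_

⊑-refl : ∀ {u} → Pointwise _≤_ u u
⊑-refl = Pointwise.refl ℕ.≤-refl

⊑-antisym : ∀ {u v} → Pointwise _≤_ u v → Pointwise _≤_ v u → u ≡ v
⊑-antisym u⊑v v⊑u = Pointwise.Pointwise-≡⇒≡ (Pointwise.antisymmetric ℕ.≤-antisym u⊑v v⊑u)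

-- `<-wellFounded` is built from `<′-wellFounded`; this identifies the accessibility proof handed on
-- in the recursion for `μ` with the canonical one.
<-wellFounded-rec : ∀ {m n} (m<′n : m ℕ.<′ n) → <′-wellFounded′ n m<′n ≡ <′-wellFounded m
<-wellFounded-rec ℕ.<′-base       = refl
<-wellFounded-rec (ℕ.<′-step m<n) = <-wellFounded-rec m<n

module _ (K : CommutativeRing c ℓ) where

  private
    module K = CommutativeRing K
    module KP = RingProperties K.ring
  open CommutativeRing K using (Carrier; _≈_; _+_; _*_; -_; 0#; 1#)
  open import Relation.Binary.Reasoning.Setoid K.setoid
  open SemiringSolver K.commutativeSemiring using (solve; _:=_; _:+_; _:*_; con)

  -- Indicators and finite sums over the cliffs

  cliffs-complete : (t : Cliff δ n) → t ∈ cliffs δ n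
  cliffs-complete {δ} t@(cliff w _ _) with size≡ K t
  ... | refl
    with z , z∈ , w≡z ← ∈-map⁻ word (subst (w ∈_) (sym (map-word-cliffs δ (length w)))
                          (boundedWords-complete (λ i → δ (suc i)) w (isCliff K t)))
    = subst (_∈ cliffs δ _) (sym (word-injective w≡z)) z∈

  𝟙-⇔ : {P Q : Set} (p? : Dec P) (q? : Dec Q) → (P → Q) → (Q → P) → 𝟙 K p? ≡ 𝟙 K q?
  𝟙-⇔ (yes p) q? f g = sym (𝟙-yes K q? (f p))
  𝟙-⇔ (no ¬p) q? f g = sym (𝟙-no K q? (¬p ∘ g))

  module _ {A : Set} where

    ∑-cong : (xs : List A) {f g : A → Carrier} → (∀ x → f x ≈ g x) → ∑ K xs f ≈ ∑ K xs g
    ∑-cong []       f≈g = K.refl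
    ∑-cong (x ∷ xs) f≈g = K.+-cong (f≈g x) (∑-cong xs f≈g)

    ∑-zero : (xs : List A) {f : A → Carrier} → All (λ x → f x ≈ 0#) xs → ∑ K xs f ≈ 0#
    ∑-zero []       []        = K.refl
    ∑-zero (x ∷ xs) (fx ∷ fs) = K.trans (K.+-cong fx (∑-zero xs fs)) (K.+-identityˡ 0#)

    ∑-+ : (xs : List A) (f g : A → Carrier) → ∑ K xs (λ x → f x + g x) ≈ ∑ K xs f + ∑ K xs g
    ∑-+ []       f g = K.sym (K.+-identityˡ 0#)
    ∑-+ (x ∷ xs) f g = K.trans (K.+-congˡ (∑-+ xs f g))
      (solve 4 (λ a b s t → (a :+ b) :+ (s :+ t) := (a :+ s) :+ (b :+ t)) K.refl (f x) (g x) (∑ K xs f) (∑ K xs g))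

    -- Uniqueness of the list ensures that the surviving term is counted once.
    ∑-single : {xs : List A} {f : A → Carrier} {t : A} → Unique xs → t ∈ xs →
               (∀ z → z ≢ t → f z ≈ 0#) → ∑ K xs f ≈ f t
    ∑-single (x∉ ∷ _) (here refl) off =
      K.trans (K.+-congˡ (∑-zero _ (All.map (λ {z} t≢z → off z (t≢z ∘ sym)) x∉))) (K.+-identityʳ _)
    ∑-single {xs = x ∷ _} (x∉ ∷ u) (there t∈) off =
      K.trans (K.+-cong (off x (All.lookup x∉ t∈)) (∑-single u t∈ off)) (K.+-identityˡ _)

  ∑-cliffs : (t : Cliff δ n) (f : Cliff δ n → Carrier) → (∀ z → word z ≢ word t → f z ≈ 0#) →
             ∑ K (cliffs δ n) f ≈ f t
  ∑-cliffs {δ} {n} t f off =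
    ∑-single (cliffs-unique δ n) (cliffs-complete t) λ z z≢t → off z (z≢t ∘ word-injective)

  -- The Möbius function

  μ-diagonal : (w t : Cliff δ n) → word w ≡ word t → μ K w t ≡ 1#
  μ-diagonal w t w≡t with word w ≟ word t
  ... | yes _  = refl
  ... | no w≢t = contradiction w≡t w≢t

  private
    -- The summand in the recursion for μ is local to μ and can only be obtained
    -- by unification.
    μ-recursion : (w t : Cliff δ n) → word w ≢ word t → ∃[ f ] μ K w t ≡ - ∑ K (cliffs δ n) f
    μ-recursion w t w≢t with word w ≟ word t
    ... | yes w≡t = contradiction w≡t w≢t
    ... | no _    = _ , refl

    -- When both comparisons hold, the local recursion runs at `z` with an accessibility proof
    -- inherited from `t`; replacing that proof by the canonical one gives `μ K w z`. Otherwise both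
    -- sides vanish.
    μ-summand : (w t : Cliff δ n) (w≢t : word w ≢ word t) (z : Cliff δ n) →
                proj₁ (μ-recursion w t w≢t) z ≈ 𝟙 K (w ≼? z) * (μ K w z * 𝟙 K (z ≺? t))
    μ-summand w t w≢t z with word w ≟ word t
    ... | yes w≡t = contradiction w≡t w≢t
    ... | no _    with w ≼? z | z ≺? t
    ... | yes w≼z | yes z≺t rewrite <-wellFounded-rec (ℕ.<⇒<′ (≺⇒sum< {u = z} {v = t} z≺t))
      = K.sym (K.trans (K.*-identityˡ _) (K.*-identityʳ _))
    ... | yes _ | no _ = K.sym (K.trans (K.*-identityˡ _) (K.zeroʳ _))
    ... | no _  | _    = K.sym (K.zeroˡ _)

    μ-sum : (w t : Cliff δ n) → word w ≢ word t →
            μ K w t ≈ - ∑ K (cliffs δ n) (λ z → 𝟙 K (w ≼? z) * (μ K w z * 𝟙 K (z ≺? t)))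
    μ-sum w t w≢t = K.trans (K.reflexive (proj₂ (μ-recursion w t w≢t)))
                            (K.-‿cong (∑-cong (cliffs _ _) (μ-summand w t w≢t)))

  -- Splits a sum over `z ≼ t` into the term at `t` and the sum over `z ≺ t`.
  𝟙-⊑ : (u t : Word) → 𝟙 K (u ⊑? t) ≈ 𝟙 K (u ≟ t) + 𝟙 K ((u ⊑? t) ×-dec ¬? (u ≟ t))
  𝟙-⊑ u t with u ⊑? t | u ≟ t
  ... | yes _  | yes _    = K.sym (K.+-identityʳ 1#)
  ... | yes _  | no _     = K.sym (K.+-identityˡ 1#)
  ... | no u⋢t | yes refl = contradiction ⊑-refl u⋢t
  ... | no _   | no _     = K.sym (K.+-identityˡ 0#)

  -- If `w` and `t` have the same word, antisymmetry leaves only `z = t`; if `w` is not below `t`,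
  -- no `z` lies between them; otherwise the recursion makes the term at `t` cancel the sum over
  -- `z ≺ t`.
  Möbius : (w t : Cliff δ n) →
           ∑ K (cliffs δ n) (λ z → 𝟙 K (w ≼? z) * (μ K w z * 𝟙 K (z ≼? t))) ≈ 𝟙 K (word w ≟ word t)
  Möbius {δ} {n} w t = cases (word w ≟ word t) (w ≼? t)
    where
    f : Cliff δ n → Carrier
    f z = 𝟙 K (w ≼? z) * (μ K w z * 𝟙 K (z ≼? t))

    vanish : ∀ z → ¬ (w ≼ z × z ≼ t) → f z ≈ 0#
    vanish z ¬wzt with w ≼? z | z ≼? t
    ... | yes w≼z | yes z≼t = contradiction (w≼z , z≼t) ¬wzt
    ... | yes _   | no _    = K.trans (K.*-congˡ (K.zeroʳ _)) (K.zeroʳ _)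
    ... | no _    | _       = K.zeroˡ _

    cases : (w≟t : Dec (word w ≡ word t)) → Dec (w ≼ t) → ∑ K (cliffs δ n) f ≈ 𝟙 K w≟t
    cases (yes w≡t) _ = begin
      ∑ K (cliffs δ n) f
        ≈⟨ ∑-cliffs t f (λ z z≢t → vanish z λ (w≼z , z≼t) →
             z≢t (⊑-antisym z≼t (subst (λ u → Pointwise _≤_ u (word z)) w≡t w≼z))) ⟩
      𝟙 K (w ≼? t) * (μ K w t * 𝟙 K (t ≼? t))
        ≡⟨ cong₂ _*_ (𝟙-yes K (w ≼? t) (subst (λ u → Pointwise _≤_ u (word t)) (sym w≡t) ⊑-refl))
                     (cong₂ _*_ (μ-diagonal w t w≡t) (𝟙-yes K (t ≼? t) ⊑-refl)) ⟩
      1# * (1# * 1#)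
        ≈⟨ K.trans (K.*-identityˡ _) (K.*-identityˡ _) ⟩
      1#  ∎
    cases (no _) (no w⋠t) = ∑-zero (cliffs δ n) (All.universal
      (λ z → vanish z λ (w≼z , z≼t) → w⋠t (Pointwise.transitive ℕ.≤-trans w≼z z≼t)) (cliffs δ n))
    cases (no w≢t) (yes w≼t) = begin
      ∑ K (cliffs δ n) f
        ≈⟨ ∑-cong (cliffs δ n) (λ z → K.trans
             (K.*-congˡ (K.*-congˡ (𝟙-⊑ (word z) (word t))))
             (solve 4 (λ a b s t → a :* (b :* (s :+ t)) := a :* (b :* s) :+ a :* (b :* t)) K.refl _ _ _ _)) ⟩
      ∑ K (cliffs δ n) (λ z → at z + below z)
        ≈⟨ ∑-+ (cliffs δ n) at below ⟩
      ∑ K (cliffs δ n) at + ∑ K (cliffs δ n) below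
        ≈⟨ K.+-congʳ (∑-cliffs t at λ z z≢t →
             K.trans (K.*-congˡ (K.trans (K.*-congˡ (K.reflexive (𝟙-no K (word z ≟ word t) z≢t))) (K.zeroʳ _))) (K.zeroʳ _)) ⟩
      𝟙 K (w ≼? t) * (μ K w t * 𝟙 K (word t ≟ word t)) + ∑ K (cliffs δ n) below
        ≡⟨ cong (_+ ∑ K (cliffs δ n) below)
             (cong₂ (λ a b → a * (μ K w t * b)) (𝟙-yes K (w ≼? t) w≼t) (𝟙-yes K (word t ≟ word t) refl)) ⟩
      1# * (μ K w t * 1#) + ∑ K (cliffs δ n) below
        ≈⟨ K.+-congʳ (K.trans (K.*-identityˡ _) (K.trans (K.*-identityʳ _) (μ-sum w t w≢t))) ⟩
      - ∑ K (cliffs δ n) below + ∑ K (cliffs δ n) below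
        ≈⟨ K.-‿inverseˡ _ ⟩
      0#  ∎
      where
      at below : Cliff δ n → Carrier
      at    z = 𝟙 K (w ≼? z) * (μ K w z * 𝟙 K (word z ≟ word t))
      below z = 𝟙 K (w ≼? z) * (μ K w z * 𝟙 K (z ≺? t))

  -- Coordinates in the fundamental basis

  -- For a cliff t of size n this is the coefficient of F_t in x, since E_w is
  -- the sum of the F_t over t ≽ w.
  F-coefficient : Word → List (Carrier × Cliff δ n) → Carrier
  F-coefficient t []            = 0#
  F-coefficient t ((a , v) ∷ x) = a * 𝟙 K (word v ⊑? t) + F-coefficient t x

  F-coefficient-++ : ∀ t (x y : List (Carrier × Cliff δ n)) →
                     F-coefficient t (x ++ y) ≈ F-coefficient t x + F-coefficient t y
  F-coefficient-++ t []            y = K.sym (K.+-identityˡ _)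
  F-coefficient-++ t ((a , v) ∷ x) y = K.trans (K.+-congˡ (F-coefficient-++ t x y)) (K.sym (K.+-assoc _ _ _))

  F-coefficient-scale : ∀ t a (x : List (Carrier × Cliff δ n)) →
                        F-coefficient t (scale K a x) ≈ a * F-coefficient t x
  F-coefficient-scale t a []            = K.sym (K.zeroʳ a)
  F-coefficient-scale t a ((b , v) ∷ x) =
    K.trans (K.+-cong (K.*-assoc _ _ _) (F-coefficient-scale t a x)) (K.sym (K.distribˡ _ _ _))

  -- Comparable words have equal length. This covers the words `t` whose size is not the arity of
  -- `x`.
  F-coefficient-size : ∀ t (x : List (Carrier × Cliff δ n)) → suc (length t) ≢ n → F-coefficient t x ≈ 0#
  F-coefficient-size t []            _   = K.refl
  F-coefficient-size t ((a , v) ∷ x) t≢n = K.trans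
    (K.+-cong (K.trans (K.*-congˡ (K.reflexive (𝟙-no K (word v ⊑? t)
                λ v⊑t → t≢n (trans (cong suc (sym (Pointwise.Pointwise-length v⊑t))) (size≡ K v))))) (K.zeroʳ a))
              (F-coefficient-size t x t≢n))
    (K.+-identityˡ 0#)

  -- The list `x` may repeat cliffs; grouping its entries by cliff shows that `F-coefficient`
  -- depends only on the coefficients of `x`.
  F-coefficient-coefficient : ∀ t (x : List (Carrier × Cliff δ n)) →
    F-coefficient t x ≈ ∑ K (cliffs δ n) (λ z → 𝟙 K (word z ⊑? t) * coefficient K (word z) x)
  F-coefficient-coefficient {δ} {n} t [] =
    K.sym (∑-zero (cliffs δ n) (All.universal (λ z → K.zeroʳ _) (cliffs δ n)))
  F-coefficient-coefficient {δ} {n} t ((a , v) ∷ x) = begin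
    a * 𝟙 K (word v ⊑? t) + F-coefficient t x
      -- A factor one is read as the indicator of `word v ≟ word v`, so that the entry becomes the
      -- value of `head` at `v`, away from which `head` vanishes.
      ≈⟨ K.+-cong (K.trans (solve 2 (λ a b → a :* b := b :* (a :* con 1)) K.refl a (𝟙 K (word v ⊑? t)))
                           (K.reflexive (cong (λ b → 𝟙 K (word v ⊑? t) * (a * b)) (sym (𝟙-yes K (word v ≟ word v) refl)))))
                  (F-coefficient-coefficient t x) ⟩
    head v + ∑ K (cliffs δ n) tail
      ≈⟨ K.+-congʳ (∑-cliffs v head λ z z≢v →
           K.trans (K.*-congˡ (K.trans (K.*-congˡ (K.reflexive (𝟙-no K (word v ≟ word z) (z≢v ∘ sym)))) (K.zeroʳ _))) (K.zeroʳ _)) ⟨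
    ∑ K (cliffs δ n) head + ∑ K (cliffs δ n) tail
      ≈⟨ ∑-+ (cliffs δ n) head tail ⟨
    ∑ K (cliffs δ n) (λ z → head z + tail z)
      ≈⟨ ∑-cong (cliffs δ n) (λ z → K.distribˡ _ _ _) ⟨
    ∑ K (cliffs δ n) (λ z → 𝟙 K (word z ⊑? t) * coefficient K (word z) ((a , v) ∷ x))  ∎
    where
    head tail : Cliff δ n → Carrier
    head z = 𝟙 K (word z ⊑? t) * (a * 𝟙 K (word v ≟ word z))
    tail z = 𝟙 K (word z ⊑? t) * coefficient K (word z) x

  -- Shows that the change of coordinates from `E` to `F` is unitriangular for `_≺_`.
  F-coefficient-≺ : ∀ (t : Cliff δ n) (x : List (Carrier × Cliff δ n)) → F-coefficient (word t) x ≈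
    coefficient K (word t) x + ∑ K (cliffs δ n) (λ z → 𝟙 K (z ≺? t) * coefficient K (word z) x)
  F-coefficient-≺ {δ} {n} t x = begin
    F-coefficient (word t) x
      ≈⟨ F-coefficient-coefficient (word t) x ⟩
    ∑ K (cliffs δ n) (λ z → 𝟙 K (z ≼? t) * coefficient K (word z) x)
      ≈⟨ ∑-cong (cliffs δ n) (λ z → K.trans (K.*-congʳ (𝟙-⊑ (word z) (word t))) (K.distribʳ _ _ _)) ⟩
    ∑ K (cliffs δ n) (λ z → at z + below z)
      ≈⟨ ∑-+ (cliffs δ n) at below ⟩
    ∑ K (cliffs δ n) at + ∑ K (cliffs δ n) below
      ≈⟨ K.+-congʳ (∑-cliffs t at λ z z≢t →
           K.trans (K.*-congʳ (K.reflexive (𝟙-no K (word z ≟ word t) z≢t))) (K.zeroˡ _)) ⟩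
    𝟙 K (word t ≟ word t) * coefficient K (word t) x + ∑ K (cliffs δ n) below
      ≈⟨ K.+-congʳ (K.trans (K.*-congʳ (K.reflexive (𝟙-yes K (word t ≟ word t) refl))) (K.*-identityˡ _)) ⟩
    coefficient K (word t) x + ∑ K (cliffs δ n) below  ∎
    where
    at below : Cliff δ n → Carrier
    at    z = 𝟙 K (word z ≟ word t) * coefficient K (word z) x
    below z = 𝟙 K (z ≺? t) * coefficient K (word z) x

  -- The unitriangular system is solved by induction on the sum of the letters: the terms strictly
  -- below `t` already agree and cancel.
  F-coefficient-injective : (x y : List (Carrier × Cliff δ n)) →
    (∀ (t : Cliff δ n) → F-coefficient (word t) x ≈ F-coefficient (word t) y) →
    ∀ (t : Cliff δ n) → coefficient K (word t) x ≈ coefficient K (word t) y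
  F-coefficient-injective {δ} {n} x y eq t = go t (<-wellFounded _)
    where
    go : ∀ (t : Cliff δ n) → Acc _<_ (sum (word t)) → coefficient K (word t) x ≈ coefficient K (word t) y
    go t (acc rec) = KP.+-cancelʳ _ _ _ (begin
      coefficient K (word t) x + ∑ K (cliffs δ n) (below x)  ≈⟨ F-coefficient-≺ t x ⟨
      F-coefficient (word t) x                               ≈⟨ eq t ⟩
      F-coefficient (word t) y                               ≈⟨ F-coefficient-≺ t y ⟩
      coefficient K (word t) y + ∑ K (cliffs δ n) (below y)  ≈⟨ K.+-congˡ (∑-cong (cliffs δ n) below-cong) ⟨
      coefficient K (word t) y + ∑ K (cliffs δ n) (below x)  ∎)
      where
      below : List (Carrier × Cliff δ n) → Cliff δ n → Carrier
      below x z = 𝟙 K (z ≺? t) * coefficient K (word z) x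

      below-cong : ∀ z → below x z ≈ below y z
      below-cong z with z ≺? t
      ... | yes z≺t = K.*-congˡ (go z (rec (≺⇒sum< {u = z} {v = t} z≺t)))
      ... | no _    = K.trans (K.zeroˡ _) (K.sym (K.zeroˡ _))

  -- Duality with the fundamental basis: the filter in `F K w` becomes the factor `𝟙 K (w ≼? z)` of
  -- the sum in `Möbius`.
  F-coefficient-F : (w t : Cliff δ n) → F-coefficient (word t) (F K w) ≈ 𝟙 K (word w ≟ word t)
  F-coefficient-F {δ} {n} w t = K.trans (terms (cliffs δ n)) (Möbius w t)
    where
    terms : ∀ zs → F-coefficient (word t) (map (λ z → μ K w z , z) (filter (w ≼?_) zs)) ≈
            ∑ K zs (λ z → 𝟙 K (w ≼? z) * (μ K w z * 𝟙 K (z ≼? t)))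
    terms []       = K.refl
    terms (z ∷ zs) with w ≼? z
    ... | yes _ = K.+-cong (K.sym (K.*-identityˡ _)) (terms zs)
    ... | no _  = K.trans (terms zs) (K.sym (K.trans (K.+-congʳ (K.zeroˡ _)) (K.+-identityˡ _)))

  F-coefficient-F-≢ : ∀ {m n} (w : Cliff δ m) (t : Cliff δ n) → word w ≢ word t →
                      F-coefficient (word t) (F K w) ≈ 0#
  F-coefficient-F-≢ {m = m} {n} w t w≢t with m ℕ.≟ n
  ... | yes refl = K.trans (F-coefficient-F w t) (K.reflexive (𝟙-no K (word w ≟ word t) w≢t))
  ... | no m≢n   = F-coefficient-size (word t) (F K w) λ t≡m → m≢n (trans (sym t≡m) (size≡ K t))

  -- By injectivity it suffices to compare coordinates at each cliff `s`, where only `t = s` can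
  -- contribute. A decidable `P` selects the terms, as vanishing in `K` need not be decidable.
  F-expansion : {P : Cliff δ n → Set} (P? : ∀ t → Dec (P t)) (x : List (Carrier × Cliff δ n)) →
    (∀ t → ¬ P t → F-coefficient (word t) x ≈ 0#) →
    RawLeftModule._≈ᴹ_ (freeModule K δ n) x
      (linearCombination (freeModule K δ n) (map (λ t → F-coefficient (word t) x , F K t) (filter P? (cliffs δ n))))
  F-expansion {δ} {n} {P} P? x off = F-coefficient-injective x (combination (cliffs δ n)) λ s → begin
    F-coefficient (word s) x
      ≈⟨ at-s s ⟩
    𝟙 K (P? s) * (F-coefficient (word s) x * 𝟙 K (word s ≟ word s))
      ≈⟨ ∑-cliffs s (λ t → 𝟙 K (P? t) * (F-coefficient (word t) x * 𝟙 K (word t ≟ word s))) (λ t t≢s →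
           K.trans (K.*-congˡ (K.trans (K.*-congˡ (K.reflexive (𝟙-no K (word t ≟ word s) t≢s))) (K.zeroʳ _))) (K.zeroʳ _)) ⟨
    ∑ K (cliffs δ n) (λ t → 𝟙 K (P? t) * (F-coefficient (word t) x * 𝟙 K (word t ≟ word s)))
      ≈⟨ terms s (cliffs δ n) ⟨
    F-coefficient (word s) (combination (cliffs δ n))  ∎
    where
    combination : List (Cliff δ n) → List (Carrier × Cliff δ n)
    combination ts = linearCombination (freeModule K δ n) (map (λ t → F-coefficient (word t) x , F K t) (filter P? ts))

    at-s : ∀ s → F-coefficient (word s) x ≈ 𝟙 K (P? s) * (F-coefficient (word s) x * 𝟙 K (word s ≟ word s))
    at-s s rewrite 𝟙-yes K (word s ≟ word s) refl with P? s
    ... | yes _  = K.sym (K.trans (K.*-identityˡ _) (K.*-identityʳ _))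
    ... | no ¬Ps = K.trans (off s ¬Ps) (K.sym (K.zeroˡ _))

    terms : ∀ s ts → F-coefficient (word s) (combination ts) ≈
            ∑ K ts (λ t → 𝟙 K (P? t) * (F-coefficient (word t) x * 𝟙 K (word t ≟ word s)))
    terms s []       = K.refl
    terms s (t ∷ ts) with P? t
    ... | no _  = K.trans (terms s ts) (K.sym (K.trans (K.+-congʳ (K.zeroˡ _)) (K.+-identityˡ _)))
    ... | yes _ = begin
      F-coefficient (word s) (scale K (F-coefficient (word t) x) (F K t) ++ combination ts)
        ≈⟨ F-coefficient-++ (word s) (scale K (F-coefficient (word t) x) (F K t)) (combination ts) ⟩
      F-coefficient (word s) (scale K (F-coefficient (word t) x) (F K t)) + F-coefficient (word s) (combination ts)
        ≈⟨ K.+-cong (K.trans (F-coefficient-scale (word s) (F-coefficient (word t) x) (F K t))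
                             (K.trans (K.*-congˡ (F-coefficient-F t s)) (K.sym (K.*-identityˡ _))))
                    (terms s ts) ⟩
      1# * (F-coefficient (word t) x * 𝟙 K (word t ≟ word s)) + _  ∎

  -- Reduction and composition in these coordinates

  -- All words occurring in `x` are cliffs, so cutting the letters of `t` down to their bounds
  -- alters no comparison.
  F-coefficient-reduction : ∀ t (x : List (Carrier × Cliff δ n)) →
                            F-coefficient t x ≈ F-coefficient (word (reduction δ t)) x
  F-coefficient-reduction         t []            = K.refl
  F-coefficient-reduction {δ = δ} t ((a , v) ∷ x) = K.+-cong
    (K.*-congˡ (K.reflexive (𝟙-⇔ (word v ⊑? t) (word v ⊑? word (reduction δ t))
      (⊑-truncation⁺ (λ i → δ (suc i)) (isCliff K v)) (⊑-truncation⁻ (λ i → δ (suc i)) t))))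
    (F-coefficient-reduction t x)

  𝟙-× : {P Q : Set} (p? : Dec P) (q? : Dec Q) → 𝟙 K (p? ×-dec q?) ≈ 𝟙 K p? * 𝟙 K q?
  𝟙-× (yes _) (yes _) = K.sym (K.*-identityˡ 1#)
  𝟙-× (yes _) (no _)  = K.sym (K.*-identityˡ 0#)
  𝟙-× (no _)  q?      = K.sym (K.zeroˡ _)

  module _ {m n : ℕ} (t : Word) (cliff-t : IsCliff δ t) (i : Fin m) where

    private
      -- Cliffs of size `suc n` have length `n`, which is the length of the block cut out of `t`.
      s = outside (toℕ i) n t
      r = inside (toℕ i) n t

    -- If the insertion is a cliff, the comparison with `t` splits in two. If not, the composite is
    -- zero, and the two comparisons cannot both hold, since they would put the insertion below the
    -- cliff `t`.
    F-coefficient-circ : (u : Cliff δ m) (v : Cliff δ (suc n)) →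
      F-coefficient t (circ K u i v) ≈ 𝟙 K (word u ⊑? s) * 𝟙 K (word v ⊑? r)
    F-coefficient-circ u v = K.trans (insertion u v refl refl) (𝟙-× (word u ⊑? s) (word v ⊑? r))
      where
      i≤u : toℕ i ≤ length (word u)
      i≤u = s≤s⁻¹ (subst (toℕ i <_) (sym (size≡ K u)) (toℕ<n i))

      ⊑⁻ : Pointwise _≤_ (word u □⟨ toℕ i ⟩ word v) t → Pointwise _≤_ (word u) s × Pointwise _≤_ (word v) r
      ⊑⁻ uv⊑t = subst (λ k → Pointwise _≤_ (word u) (outside (toℕ i) k t) × Pointwise _≤_ (word v) (inside (toℕ i) k t))
                  (ℕ.suc-injective (size≡ K v)) (□-⊑⁻ (toℕ i) (word u) (word v) t i≤u uv⊑t)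

      ⊑⁺ : Pointwise _≤_ (word u) s × Pointwise _≤_ (word v) r → Pointwise _≤_ (word u □⟨ toℕ i ⟩ word v) t
      ⊑⁺ uv⊑ with u⊑ , v⊑ ← subst (λ k → Pointwise _≤_ (word u) (outside (toℕ i) k t) × Pointwise _≤_ (word v) (inside (toℕ i) k t))
                                 (sym (ℕ.suc-injective (size≡ K v))) uv⊑
             = □-⊑⁺ (toℕ i) (word u) (word v) t i≤u u⊑ v⊑

      -- `circ` computes only on constructors; matching on copies of `u` and `v` exposes them while
      -- keeping `⊑⁻` and `⊑⁺` usable.
      insertion : ∀ u′ v′ → u′ ≡ u → v′ ≡ v →
                  F-coefficient t (circ K u′ i v′) ≈ 𝟙 K ((word u ⊑? s) ×-dec (word v ⊑? r))
      insertion (cliff _ _ _) (cliff _ _ _) refl refl with isCliff? δ (word u □⟨ toℕ i ⟩ word v)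
      ... | yes _  = K.trans (K.+-identityʳ _) (K.trans (K.*-identityˡ _)
                       (K.reflexive (𝟙-⇔ ((word u □⟨ toℕ i ⟩ word v) ⊑? t) ((word u ⊑? s) ×-dec (word v ⊑? r)) ⊑⁻ ⊑⁺)))
      ... | no ¬uv = K.reflexive (sym (𝟙-no K ((word u ⊑? s) ×-dec (word v ⊑? r))
                       λ uv⊑ → ¬uv (⊑-bounded (λ i → δ (suc i)) (⊑⁺ uv⊑) cliff-t)))

    F-coefficient-∘ : (x : List (Carrier × Cliff δ m)) (y : List (Carrier × Cliff δ (suc n))) →
      F-coefficient t (compose K x i y) ≈ F-coefficient s x * F-coefficient r y
    F-coefficient-∘ []            y = K.sym (K.zeroˡ _)
    F-coefficient-∘ ((a , u) ∷ x) y = begin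
      F-coefficient t (row y ++ compose K x i y)
        ≈⟨ F-coefficient-++ t (row y) (compose K x i y) ⟩
      F-coefficient t (row y) + F-coefficient t (compose K x i y)
        ≈⟨ K.+-cong (F-coefficient-row y) (F-coefficient-∘ x y) ⟩
      (a * 𝟙 K (word u ⊑? s)) * F-coefficient r y + F-coefficient s x * F-coefficient r y
        ≈⟨ K.distribʳ _ _ _ ⟨
      (a * 𝟙 K (word u ⊑? s) + F-coefficient s x) * F-coefficient r y  ∎
      where
      row : List (Carrier × Cliff δ (suc n)) → List (Carrier × Cliff δ (m ℕ.+ suc n ∸ 1))
      row = concatMap λ (b , v) → scale K (a * b) (circ K u i v)

      F-coefficient-row : ∀ y → F-coefficient t (row y) ≈ (a * 𝟙 K (word u ⊑? s)) * F-coefficient r y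
      F-coefficient-row []            = K.sym (K.zeroʳ _)
      F-coefficient-row ((b , v) ∷ y) = begin
        F-coefficient t (scale K (a * b) (circ K u i v) ++ row y)
          ≈⟨ F-coefficient-++ t (scale K (a * b) (circ K u i v)) (row y) ⟩
        F-coefficient t (scale K (a * b) (circ K u i v)) + F-coefficient t (row y)
          ≈⟨ K.+-cong (K.trans (F-coefficient-scale t (a * b) (circ K u i v)) (K.*-congˡ (F-coefficient-circ u v)))
                      (F-coefficient-row y) ⟩
        (a * b) * (𝟙 K (word u ⊑? s) * 𝟙 K (word v ⊑? r)) + (a * 𝟙 K (word u ⊑? s)) * F-coefficient r y
          ≈⟨ solve 5 (λ a b p q Y → (a :* b) :* (p :* q) :+ (a :* p) :* Y := (a :* p) :* (b :* q :+ Y)) K.refl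
                     a b (𝟙 K (word u ⊑? s)) (𝟙 K (word v ⊑? r)) (F-coefficient r y) ⟩
        (a * 𝟙 K (word u ⊑? s)) * (b * 𝟙 K (word v ⊑? r) + F-coefficient r y)  ∎

  -- After reduction of `t` this is duality. Words are compared because the two sizes may differ.
  F-coefficient-F-reduction : ∀ (w : Cliff δ n) t → word w ≢ word (reduction δ t) → F-coefficient t (F K w) ≈ 0#
  F-coefficient-F-reduction {δ} w t w≢ =
    K.trans (F-coefficient-reduction t (F K w)) (F-coefficient-F-≢ w (reduction δ t) w≢)

  -- The ideal attached to a set closed by subword reduction

  module _ (unimodal : Unimodal δ) {S : GradedSubset δ p} (closed : ClosedBySubwordReduction S) where

    open RawOperad (cliffRawOperad K δ) using (Op)

    private
      leftModule : ℕ → LeftModule K.ring c ℓ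
      leftModule n = record { isLeftModule = freeModule-isLeftModule K δ n }

      module I = IsOperad (cliffIsOperad K unimodal)

      V-submodule : ∀ n → IsSubmodule (freeModule K δ n) (𝒱 K S n)
      V-submodule n = span-isSubmodule (leftModule n) _

      module V {n} = IsSubmodule (V-submodule n)

    -- The expansion of `x` along the `F K t` with `P t` puts it in the span; the decidable `P`
    -- stands in for the complement of `S`, which need not be decidable.
    𝒱-criterion : {P : Cliff δ n → Set} (P? : ∀ t → Dec (P t)) → (∀ t → P t → ¬ S n t) →
      (x : Op n) → (∀ t → ¬ P t → F-coefficient (word t) x ≈ 0#) → 𝒱 K S n x
    𝒱-criterion {n} P? P⇒¬S x off =
      map (λ t → F-coefficient (word t) x , F K t) (filter P? (cliffs δ n)) ,
      All.map⁺ (All.map (λ {t} Pt → t , P⇒¬S t Pt , refl) (All.all-filter P? (cliffs δ n))) ,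
      F-expansion P? x off

    -- Contrapositive of closure, `w` being the reduction of a subword of `t`.
    ¬S-superword : ∀ {m n} (w : Cliff δ m) → ¬ S m w → (t : Cliff δ n) {w′ : Word} → w′ ⊆ word t →
                   word w ≡ word (reduction δ w′) → ¬ S n t
    ¬S-superword w w∉S t {w′} w′⊆t w≡ t∈S = w∉S (word-cong w≡ (closed t t∈S w′ w′⊆t))
      where
      word-cong : ∀ {m n} {u : Cliff δ m} {v : Cliff δ n} → word u ≡ word v → S n v → S m u
      -- `S` is indexed by size, so the sizes must be identified before the cliffs.
      word-cong {u = u} {v} u≡v v∈S with trans (sym (size≡ K u)) (trans (cong (suc ∘ length) u≡v) (size≡ K v))
      ... | refl with refl ← word-injective {u = u} {v = v} u≡v = v∈S

    -- A coordinate at `t` can be nonzero only if the part of `t` outside the inserted block reduces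
    -- to `w`, and then `t` is not in `S`.
    F-∘-closed : ∀ {m n} (w : Cliff δ m) → ¬ S m w → (i : Fin m) (y : Op n) → 𝒱 K S _ (compose K (F K w) i y)
    -- No cliff has size zero, so `y` is the empty combination.
    F-∘-closed {n = zero} w _ i y
      rewrite arity-zero K y | compose-zeroʳ K {n = 0} (F K w) i = V.0-closed
    F-∘-closed {n = suc n} w w∉S i y = 𝒱-criterion
      (λ t → word w ≟ word (reduction δ (outside (toℕ i) n (word t))))
      (λ t → ¬S-superword w w∉S t (outside-⊆ (toℕ i) n (word t)))
      (compose K (F K w) i y)
      λ t w≢ → K.trans (F-coefficient-∘ (word t) (isCliff K t) i (F K w) y)
                 (K.trans (K.*-congʳ (F-coefficient-F-reduction w _ w≢)) (K.zeroˡ _))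

    -- As for `F-∘-closed`, with the inserted block of `t` instead of its complement.
    ∘-F-closed : ∀ {m n} (x : Op m) (i : Fin m) (w : Cliff δ n) → ¬ S n w → 𝒱 K S _ (compose K x i (F K w))
    ∘-F-closed {n = zero} x i w w∉S with () ← size≡ K w
    ∘-F-closed {n = suc n} x i w w∉S = 𝒱-criterion
      (λ t → word w ≟ word (reduction δ (inside (toℕ i) n (word t))))
      (λ t → ¬S-superword w w∉S t (inside-⊆ (toℕ i) n (word t)))
      (compose K x i (F K w))
      λ t w≢ → K.trans (F-coefficient-∘ (word t) (isCliff K t) i x (F K w))
                 (K.trans (K.*-congˡ (F-coefficient-F-reduction w _ w≢)) (K.zeroʳ _))

    𝒱-isOperadIdeal : IsOperadIdeal (cliffOperad K unimodal) (𝒱 K S)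
    𝒱-isOperadIdeal = record
      { isSubmodule = V-submodule
      ; ∘-closedˡ   = λ {m} {n} {x} i y → span-image (leftModule m) (leftModule _) (λ x → compose K x i y)
          (λ {x} {x′} x≈x′ → I.∘-cong {x = x} {x′} {y} {y} i x≈x′ λ _ → K.refl)
          (λ x x′ → I.∘-distribʳ x x′ i y) (λ a x → I.∘-*ₗˡ a x i y)
          (V-submodule _) (λ { (w , w∉S , refl) → F-∘-closed w w∉S i y }) {x}
      ; ∘-closedʳ   = λ {m} {n} x i {y} → span-image (leftModule n) (leftModule _) (compose K x i)
          (λ {y} {y′} y≈y′ → I.∘-cong {x = x} {x} {y} {y′} i (λ _ → K.refl) y≈y′)
          (I.∘-distribˡ x i) (λ a y → I.∘-*ₗʳ a x i y)
          (V-submodule _) (λ { (w , w∉S , refl) → ∘-F-closed x i w w∉S }) {y}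
      }

proposition3p1p1 : ∀ {c ℓ p : Level} (K : CommutativeRing c ℓ) → IsField K → CharacteristicZero K →
    (δ : RangeMap) (unimodal : Unimodal δ) (S : GradedSubset δ p) → Nonempty S →
    ClosedBySubwordReduction S →
    IsOperadIdeal (cliffOperad K unimodal) (𝒱 K S) ×
    IsOperad (cliffOperad K unimodal / 𝒱 K S) ×
    IsOperadEpimorphism (cliffRawOperad K δ) (cliffOperad K unimodal / 𝒱 K S) (λ n → id)
-- δ is given explicitly because inference finds its η-expansion, and comparing
-- the operads of the two forms unfolds them completely.
proposition3p1p1 K _ _ δ unimodal S _ closed =
  ideal ,
  quotient-isOperad (cliffOperad K {δ} unimodal) ideal ,
  projection-isOperadEpimorphism (cliffOperad K {δ} unimodal) ideal
  where
  ideal = 𝒱-isOperadIdeal K {δ = δ} unimodal {S = S} closed
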